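{- Let $\mathcal{A}$ be the ring of integer matrices with rows and columns indexed by the positive integers such that each row has only finitely many nonzero entries. For $A \in \mathcal{A}$ and $n \ge 1$ put $\tau_{A,n} = \sum_{k \ge 1} A_{kn}\tau_k$ (a statistic on $\mathfrak{S}(1243,2143)$), and with indeterminates $q_1, q_2, \ldots$ define $$F_A(\mathbf{q}) = \sum_{\pi \in \mathfrak{S}(1243,2143)} \prod_{k\ge 1} q_k^{\tau_{A,k}(\pi)}, \qquad C_A(\mathbf{q}) = 1 + \cfrac{M_1}{1 - M_1 - \cfrac{M_2}{1 - M_2 - \cfrac{M_3}{1 - M_3 - \cdots}}},$$ where $M_i = \prod_{k \ge 1} q_k^{A_{ik}}$. Let $B \in \mathcal{A}$ be the matrix with $B_{ij} = \binom{i-1}{j-1}$ (with $\binom{i}{j} = 0$ if $i<j$). Then for all $A \in \mathcal{A}$, $F_A(\mathbf{q}) = C_{BA}(\mathbf{q})$ and $C_A(\mathbf{q}) = F_{B^{ -1}A}(\mathbf{q})$. In particular, the set of Schröder continued fractions is exactly the set of generating functions for countable families of statistics on $\mathfrak{S}(1243,2143)$ in which each statistic is a (possibly infinite) linear combination of the $\tau_k$'s and each $\tau_k$ appears in only finitely many of the statistics.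
   Context: A permutation avoids a pattern $\sigma$ if it has no subsequence with the same relative order as $\sigma$. $\mathfrak{S}(1243,2143)$ is the set of all permutations (including the empty one) avoiding $1243$ and $2143$. For $k\ge1$, $\tau_k(\pi)$ is the number of increasing subsequences of length $k$ in $\pi$. A Schröder continued fraction is a continued fraction of the form $1 + \cfrac{m_0}{1-m_0 - \cfrac{m_1}{1-m_1-\cfrac{m_2}{1-m_2-\cdots}}}$ where each $m_i$ is a monic monomial in a given set of variables. -}

module Defs where

open import Data.Bool using (Bool; true; false; _∧_; not; if_then_else_)
open import Data.Nat using (ℕ; zero; suc; _≤_; _∸_; _<ᵇ_; _≡ᵇ_)
open import Data.Nat.Combinatorics using (_C_)
open import Data.Integer using (ℤ; +_; -_; _*_; _+_)
open import Data.List using (List; []; _∷_; _++_; map; filter; length; foldr; zip; concatMap; applyUpTo; upTo)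
open import Data.Bool.ListAction using (all; any)
open import Data.Product using (_×_; _,_; ∃-syntax)
open import Relation.Binary.PropositionalEquality using (_≡_; _→-setoid_)
open import Relation.Nullary.Decidable using (does)
open import Data.List.Relation.Binary.Permutation.Setoid (ℕ →-setoid ℤ) as Perm using ()
open import Data.Bool.Properties using () renaming (_≟_ to _≟ᵇ_)
open import Relation.Nullary using (yes; no)

-- Permutations, stored as lists of values 0 … n-1 (one-line notation)

words : ℕ → ℕ → List (List ℕ)
words zero    k = [] ∷ []
words (suc n) k = concatMap (λ x → map (x ∷_) (words n k)) (upTo k)

notIn : ℕ → List ℕ → Bool
notIn x xs = all (λ y → not (x ≡ᵇ y)) xs

distinct : List ℕ → Bool
distinct []       = true
distinct (x ∷ xs) = notIn x xs ∧ distinct xs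

perms : ℕ → List (List ℕ)
perms n = filter (λ w → distinct w ≟ᵇ true) (words n n)

subseqs : List ℕ → List (List ℕ)
subseqs []       = [] ∷ []
subseqs (x ∷ xs) = map (x ∷_) (subseqs xs) ++ subseqs xs

beq : Bool → Bool → Bool
beq true  b = b
beq false b = not b

-- s and σ have the same relative order (assuming equal lengths)
sameOrder : List ℕ → List ℕ → Bool
sameOrder s σ =
  all (λ { (x , a) → all (λ { (y , b) → beq (x <ᵇ y) (a <ᵇ b) }) ps }) ps
  where ps = zip s σ

contains : List ℕ → List ℕ → Bool
contains σ π =
  any (λ s → (length s ≡ᵇ length σ) ∧ sameOrder s σ) (subseqs π)

p1243 p2143 : List ℕ
p1243 = 1 ∷ 2 ∷ 4 ∷ 3 ∷ []
p2143 = 2 ∷ 1 ∷ 4 ∷ 3 ∷ []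

avoids : List ℕ → Bool
avoids π = not (contains p1243 π) ∧ not (contains p2143 π)

avoiders : ℕ → List (List ℕ)
avoiders n = filter (λ π → avoids π ≟ᵇ true) (perms n)

increasing : List ℕ → Bool
increasing []           = true
increasing (x ∷ [])     = true
increasing (x ∷ y ∷ xs) = (x <ᵇ y) ∧ increasing (y ∷ xs)

τ : ℕ → List ℕ → ℕ
τ k π = length (filter (λ s → ((length s ≡ᵇ k) ∧ increasing s) ≟ᵇ true) (subseqs π))

-- Integer matrices indexed by positive integers.
-- Convention: Agda index i stands for the paper's index i+1.

Matrix : Set
Matrix = ℕ → ℕ → ℤ

RowFinite : Matrix → Set
RowFinite A = ∀ i → ∃[ N ] (∀ k → N ≤ k → A i k ≡ + 0)

sumℤ : List ℤ → ℤ
sumℤ = foldr _+_ (+ 0)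

B : Matrix
B i j = + (i C j)

sgn : ℕ → ℤ
sgn zero          = + 1
sgn (suc zero)    = - (+ 1)
sgn (suc (suc n)) = sgn n

Binv : Matrix
Binv i j = sgn (i ∸ j) * + (i C j)

-- product L · A for a lower-triangular L (the sum over k is then finite)
lowerMul : Matrix → Matrix → Matrix
lowerMul L A i j = sumℤ (map (λ k → L i k * A k j) (upTo (suc i)))

-- Laurent monomials in q_1, q_2, …: exponent vectors (index k ↦ exponent of q_{k+1})

Mon : Set
Mon = ℕ → ℤ

one : Mon
one _ = + 0

_·_ : Mon → Mon → Mon
(m · m') k = m k + m' k

-- A "series coefficient" with nonnegative integer coefficients is represented
-- as the multiset (list) of its monomials; equality is multiset equality
-- (permutation up to pointwise equality of exponent vectors).
Poly : Set
Poly = List Mon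

_⊗_ : Poly → Poly → Poly
p ⊗ p' = concatMap (λ m → map (m ·_) p') p

infix 3 _≈ₘ_
_≈ₘ_ : Poly → Poly → Set
_≈ₘ_ = Perm._↭_

-- The generating function F_A, graded by length: the multiset of weights
-- ∏_n q_n^{τ_{A,n}(π)} over π ∈ 𝔖_len(1243,2143), where
-- τ_{A,n}(π) = Σ_{k≥1} A_{kn} τ_k(π) (terms with k > |π| vanish).

weight : Matrix → List ℕ → Mon
weight A π n = sumℤ (map (λ k → A k n * + (τ (suc k) π)) (upTo (length π)))

Fcoef : Matrix → ℕ → Poly
Fcoef A len = map (weight A) (avoiders len)

-- The Schröder continued fraction C_A, graded by the number of M-factors
-- (i.e. replace each M_i by t M_i and take the coefficient of t^len).
-- M_i = ∏_k q_k^{A_{ik}};  C = 1 + M_1 t G_1  with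
-- G_h = 1 / (1 - t M_h - t M_{h+1} G_{h+1}), i.e.
-- G_h = 1 + t M_h G_h + t M_{h+1} G_{h+1} G_h.

M : Matrix → ℕ → Mon
M A i k = A i k

-- Gfuel A n h a = [t^a] G_{h+1}, valid when a ≤ n (fuel n)
Gfuel : Matrix → ℕ → ℕ → ℕ → Poly
Gfuel A zero    h a       = one ∷ []
Gfuel A (suc n) h zero    = one ∷ []
Gfuel A (suc n) h (suc a) =
  ((M A h ∷ []) ⊗ Gfuel A n h a)
  ++ concatMap (λ i → (M A (suc h) ∷ []) ⊗ (Gfuel A n (suc h) i ⊗ Gfuel A n h (a ∸ i)))
               (upTo (suc a))

Gcoef : Matrix → ℕ → ℕ → Poly
Gcoef A h a = Gfuel A a h a

Ccoef : Matrix → ℕ → Poly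
Ccoef A zero      = one ∷ []
Ccoef A (suc len) = (M A 0 ∷ []) ⊗ Gcoef A 0 len

{-# OPTIONS --safe #-}

-- Let π avoid 1243 and 2143 and have length at least 2.  Either π starts with its maximum, or
-- π = K · max · R with K nonempty.  In the latter case at most one entry of K is smaller than a
-- given entry of R, so all of R lies below every entry of K except its minimum m; hence π is
-- determined by the pattern L of K and by σ = m R, and L and σ are arbitrary nonempty avoiders.
-- An increasing subsequence of π is an increasing subsequence of K · max or of m R, so passing
-- from L to K · max turns τ_k into τ_k + τ_(k-1), i.e. replaces row k of A by the sum of rows k
-- and k + 1.  By Pascal's rule this deletes the first row of BA.  With F′ for the shifted matrix,
-- F - 1 = M₁ + M₁ (F - 1) + (F′ - 1) (F - 1), which is the recursion of the continued fraction.
module Submission where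

open import Defs
open import Data.Bool using (Bool; true; false; _∧_; not; if_then_else_; T)
open import Data.Bool.Properties using (T-≡; T-∧; T-not-≡; ∧-zeroʳ) renaming (_≟_ to _≟ᵇ_)
open import Data.Empty using (⊥; ⊥-elim)
open import Data.Integer as ℤ using (ℤ; +_; -_; _+_; _*_)
import Data.Integer.Properties as ℤ
open import Data.Integer.Tactic.RingSolver using (solve-∀)
open import Data.List using (List; []; _∷_; _++_; map; length; filter; concatMap; zip; applyUpTo; upTo)
open import Data.List.Membership.Propositional using (_∈_; _∉_; find; lose)
open import Data.List.Membership.Propositional.Properties
open import Data.List.Membership.Propositional.Properties.WithK using (unique∧set⇒bag)
open import Data.List.Properties using (map-upTo; filter-++; length-++; length-map; length-upTo; map-∘; map-++; map-concatMap; concatMap-cong; ++-identityʳ; ∷-injective; ∷-injectiveˡ; ∷-injectiveʳ)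
open import Data.List.Relation.Binary.BagAndSetEquality using (∼bag⇒↭)
import Data.List.Relation.Binary.Permutation.Propositional as ↭
open import Data.List.Relation.Binary.Pointwise as Pointwise using ([]; _∷_)
open import Data.List.Relation.Binary.Sublist.Propositional using (_⊆_; []; _∷_; _∷ʳ_; ⊆-trans; ⊆-refl; minimum; from∈; lookup)
open import Data.List.Relation.Binary.Sublist.Propositional.Properties using (++⁺; ++⁺ˡ; ++⁺ʳ; map⁺; All-resp-⊆)
open import Data.List.Relation.Unary.All as All using (All; []; _∷_)
import Data.List.Relation.Unary.All.Properties as All
open import Data.List.Relation.Unary.AllPairs as AllPairs using ([]; _∷_)
open import Data.List.Relation.Unary.Any as Any using (here; there)
import Data.List.Relation.Unary.Any.Properties as Any
open import Data.List.Relation.Unary.Unique.Propositional using (Unique)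
import Data.List.Relation.Unary.Unique.Propositional.Properties as Unique
open import Data.Nat as ℕ using (ℕ; zero; suc; _∸_; _<_; _≤_; s≤s; z≤n; _<ᵇ_; _≡ᵇ_)
open import Data.Nat.Combinatorics using (_C_; nCk+nC[k+1]≡[n+1]C[k+1]; k>n⇒nCk≡0)
import Data.Nat.Properties as ℕ
open import Data.List.Membership.DecPropositional ℕ._≟_ using (_∈?_)
open import Data.Product using (_×_; _,_; ∃₂; ∃-syntax; proj₁; proj₂; uncurry)
open import Data.Sum using (_⊎_; inj₁; inj₂; [_,_]′)
open import Function using (_∘_; Equivalence; mk⇔)
open import Relation.Binary.Definitions using (tri<; tri≈; tri>)
open import Relation.Binary.PropositionalEquality
open import Relation.Nullary using (yes; no; ¬_)
open import Data.List.Relation.Binary.Permutation.Setoid (ℕ →-setoid ℤ) as Perm using (prep; swap; ↭-refl; ↭-sym; ↭-trans)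
open import Data.List.Relation.Binary.Permutation.Setoid.Properties (ℕ →-setoid ℤ) using (shifts) renaming (++⁺ to ++-cong)
open Equivalence using (to; from)

-- Triangular matrices with a Pascal recursion

∑ : ℕ → (ℕ → ℤ) → ℤ
∑ n f = sumℤ (applyUpTo f n)

∑-cong : ∀ n {f g : ℕ → ℤ} → f ≗ g → ∑ n f ≡ ∑ n g
∑-cong zero    f≗g = refl
∑-cong (suc n) f≗g = cong₂ _+_ (f≗g 0) (∑-cong n (f≗g ∘ suc))

∑-zero : ∀ n {f : ℕ → ℤ} → (∀ k → f k ≡ + 0) → ∑ n f ≡ + 0
∑-zero zero    f≡0 = refl
∑-zero (suc n) f≡0 = cong₂ _+_ (f≡0 0) (∑-zero n (f≡0 ∘ suc))

∑-distrib-+ : ∀ n (f g : ℕ → ℤ) → ∑ n (λ k → f k + g k) ≡ ∑ n f + ∑ n g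
∑-distrib-+ zero    f g = refl
∑-distrib-+ (suc n) f g = begin
  f 0 + g 0 + ∑ n (λ k → f (suc k) + g (suc k))  ≡⟨ cong (_+_ (f 0 + g 0)) (∑-distrib-+ n (f ∘ suc) (g ∘ suc)) ⟩
  f 0 + g 0 + (∑ n (f ∘ suc) + ∑ n (g ∘ suc))    ≡⟨ interchange (f 0) (g 0) (∑ n (f ∘ suc)) (∑ n (g ∘ suc)) ⟩
  f 0 + ∑ n (f ∘ suc) + (g 0 + ∑ n (g ∘ suc))    ∎
  where
  open ≡-Reasoning
  interchange : ∀ w x y z → w + x + (y + z) ≡ w + y + (x + z)
  interchange = solve-∀

∑-distribˡ-* : ∀ n c (f : ℕ → ℤ) → ∑ n (λ k → c * f k) ≡ c * ∑ n f
∑-distribˡ-* zero    c f = sym (ℤ.*-zeroʳ c)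
∑-distribˡ-* (suc n) c f =
  trans (cong (_+_ (c * f 0)) (∑-distribˡ-* n c (f ∘ suc))) (sym (ℤ.*-distribˡ-+ c (f 0) (∑ n (f ∘ suc))))

∑-last : ∀ n (f : ℕ → ℤ) → ∑ (suc n) f ≡ ∑ n f + f n
∑-last zero    f = ℤ.+-comm (f 0) (+ 0)
∑-last (suc n) f = trans (cong (_+_ (f 0)) (∑-last n (f ∘ suc))) (sym (ℤ.+-assoc (f 0) (∑ n (f ∘ suc)) (f (suc n))))

lowerMul-∑ : ∀ L A i j → lowerMul L A i j ≡ ∑ (suc i) (λ k → L i k * A k j)
lowerMul-∑ L A i j = cong sumℤ (map-upTo (λ k → L i k * A k j) (suc i))

row : Matrix → ℕ → (ℕ → ℤ) → ℤ
row L i a = ∑ (suc i) (λ k → L i k * a k)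

row-cong : ∀ L i {a b : ℕ → ℤ} → a ≗ b → row L i a ≡ row L i b
row-cong L i a≗b = ∑-cong (suc i) (λ k → cong (L i k *_) (a≗b k))

row-distrib-+ : ∀ L i (a b : ℕ → ℤ) → row L i (λ k → a k + b k) ≡ row L i a + row L i b
row-distrib-+ L i a b = trans
  (∑-cong (suc i) (λ k → ℤ.*-distribˡ-+ (L i k) (a k) (b k)))
  (∑-distrib-+ (suc i) (λ k → L i k * a k) (λ k → L i k * b k))

-- With α = 1 this describes `B` and with α = -1 it describes `Binv`, so one computation serves
-- both. The field `lower` concerns the entry just right of the diagonal, by which the two truncated
-- sums in `row-suc` differ.
record Pascal (α : ℤ) (L : Matrix) : Set where
  field
    first : ∀ i → L (suc i) 0 ≡ α * L i 0
    step  : ∀ i j → L (suc i) (suc j) ≡ L i j + α * L i (suc j)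
    lower : ∀ i → L i (suc i) ≡ + 0

-- With E the shift of sequences, row i of `L` evaluates (E + α)^i at index 0, up to the factor
-- `L 0 0`. Here the factor E + α that acts first is split off and applied to the sequence.
row-suc : ∀ {α L} → Pascal α L → ∀ i a → row L (suc i) a ≡ row L i (λ k → a (suc k) + α * a k)
row-suc {α} {L} P i a = begin
  L (suc i) 0 * a 0 + ∑ (suc i) (λ k → L (suc i) (suc k) * a (suc k))
    ≡⟨ cong₂ (λ x y → x * a 0 + y) (first i) (∑-cong (suc i) λ k → trans (cong (_* a (suc k)) (step i k)) (expand α (L i k) (L i (suc k)) (a (suc k)))) ⟩
  α * L i 0 * a 0 + ∑ (suc i) (λ k → L i k * a (suc k) + α * (L i (suc k) * a (suc k)))
    ≡⟨ cong (_+_ (α * L i 0 * a 0)) (trans (∑-distrib-+ (suc i) (λ k → L i k * a (suc k)) (λ k → α * (L i (suc k) * a (suc k)))) (cong (_+_ (row L i (a ∘ suc))) (∑-distribˡ-* (suc i) α (λ k → L i (suc k) * a (suc k))))) ⟩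
  α * L i 0 * a 0 + (row L i (a ∘ suc) + α * ∑ (suc i) (λ k → L i (suc k) * a (suc k)))
    ≡⟨ collect α (L i 0) (a 0) (row L i (a ∘ suc)) (∑ (suc i) (λ k → L i (suc k) * a (suc k))) ⟩
  row L i (a ∘ suc) + α * ∑ (suc (suc i)) (λ k → L i k * a k)
    ≡⟨ cong (λ z → row L i (a ∘ suc) + α * z) (trans (∑-last (suc i) (λ k → L i k * a k)) (trans (cong (λ z → row L i a + z * a (suc i)) (lower i)) (ℤ.+-identityʳ (row L i a)))) ⟩
  row L i (a ∘ suc) + α * row L i a
    ≡⟨ cong (_+_ (row L i (a ∘ suc))) (trans (sym (∑-distribˡ-* (suc i) α (λ k → L i k * a k))) (∑-cong (suc i) λ k → commute α (L i k) (a k))) ⟩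
  row L i (a ∘ suc) + row L i (λ k → α * a k)
    ≡⟨ sym (row-distrib-+ L i (a ∘ suc) (λ k → α * a k)) ⟩
  row L i (λ k → a (suc k) + α * a k) ∎
  where
  open ≡-Reasoning
  open Pascal P
  expand : ∀ α x y z → (x + α * y) * z ≡ x * z + α * (y * z)
  expand = solve-∀
  collect : ∀ α x y r s → α * x * y + (r + α * s) ≡ r + α * (x * y + s)
  collect = solve-∀
  commute : ∀ α x y → α * (x * y) ≡ x * (α * y)
  commute = solve-∀

B-Pascal : Pascal (+ 1) B
B-Pascal = record
  { first = λ i → refl
  ; step  = λ i j → trans (cong +_ (sym (nCk+nC[k+1]≡[n+1]C[k+1] i j)))
                          (cong (λ z → B i j + z) (sym (ℤ.*-identityˡ (B i (suc j)))))
  ; lower = λ i → cong +_ (k>n⇒nCk≡0 (ℕ.n<1+n i))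
  }

sgn-suc : ∀ n → sgn (suc n) ≡ - sgn n
sgn-suc zero          = refl
sgn-suc (suc zero)    = refl
sgn-suc (suc (suc n)) = sgn-suc n

Binv-Pascal : Pascal (- (+ 1)) Binv
Binv-Pascal = record { first = first ; step = step ; lower = lower }
  where
  open ≡-Reasoning
  neg : ∀ x y → - x * y ≡ - (+ 1) * (x * y)
  neg = solve-∀
  first : ∀ i → Binv (suc i) 0 ≡ - (+ 1) * Binv i 0
  first i = trans (cong (_* + 1) (sgn-suc i)) (neg (sgn i) (+ 1))
  flip : ∀ i j → sgn (i ∸ j) * B i (suc j) ≡ - (+ 1) * Binv i (suc j)
  flip i j with suc j ℕ.≤? i
  ... | yes j<i = trans (cong (_* B i (suc j)) (trans (cong sgn (sym (ℕ.suc-pred (i ∸ j) {{ℕ.>-nonZero (ℕ.m<n⇒0<n∸m j<i)}}))) (trans (sgn-suc (ℕ.pred (i ∸ j))) (cong (-_ ∘ sgn) (ℕ.pred[m∸n]≡m∸[1+n] i j)))))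
                        (neg (sgn (i ∸ suc j)) (B i (suc j)))
  -- Here truncated subtraction stops the alternation of signs, but the binomial coefficient
  -- vanishes on both sides.
  ... | no  j≮i rewrite k>n⇒nCk≡0 (ℕ.≰⇒> j≮i) | ℤ.*-zeroʳ (sgn (i ∸ j)) | ℤ.*-zeroʳ (sgn (i ∸ suc j)) = refl
  step : ∀ i j → Binv (suc i) (suc j) ≡ Binv i j + - (+ 1) * Binv i (suc j)
  step i j = begin
    sgn (i ∸ j) * + (suc i C suc j)                ≡⟨ cong (λ z → sgn (i ∸ j) * + z) (sym (nCk+nC[k+1]≡[n+1]C[k+1] i j)) ⟩
    sgn (i ∸ j) * (B i j + B i (suc j))            ≡⟨ ℤ.*-distribˡ-+ (sgn (i ∸ j)) (B i j) (B i (suc j)) ⟩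
    Binv i j + sgn (i ∸ j) * B i (suc j)           ≡⟨ cong (_+_ (Binv i j)) (flip i j) ⟩
    Binv i j + - (+ 1) * Binv i (suc j)            ∎
  lower : ∀ i → Binv i (suc i) ≡ + 0
  lower i rewrite k>n⇒nCk≡0 (ℕ.n<1+n i) = ℤ.*-zeroʳ (sgn (i ∸ suc i))

-- The change of coefficients caused by appending a maximum: every increasing subsequence is counted
-- as it is and once more with the maximum at its end.
up : (ℕ → ℤ) → ℕ → ℤ
up a k = a k + a (suc k)

B-row-suc : ∀ i a → row B (suc i) a ≡ row B i (up a)
B-row-suc i a = trans (row-suc B-Pascal i a)
  (row-cong B i λ k → trans (cong (_+_ (a (suc k))) (ℤ.*-identityˡ (a k))) (ℤ.+-comm (a (suc k)) (a k)))

-- Induction on i for all sequences at once: passing from row i to row i + 1 of `B` turns into a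
-- shift of `a`.
B∘Binv : ∀ i a → row B i (λ k → row Binv k a) ≡ a i
B∘Binv zero    a = unit (a 0)
  where
  unit : ∀ x → + 1 * (+ 1 * x + + 0) + + 0 ≡ x
  unit = solve-∀
B∘Binv (suc i) a = begin
  row B (suc i) (λ k → row Binv k a)                                    ≡⟨ B-row-suc i (λ k → row Binv k a) ⟩
  row B i (λ k → row Binv k a + row Binv (suc k) a)                     ≡⟨ row-cong B i telescope ⟩
  row B i (λ k → row Binv k (a ∘ suc))                                  ≡⟨ B∘Binv i (a ∘ suc) ⟩
  a (suc i)                                                             ∎
  where
  open ≡-Reasoning
  cancel : ∀ x y → x + (y + - (+ 1) * x) ≡ y
  cancel = solve-∀
  -- Row k + 1 of `Binv` is row k applied to the differences of `a`; adding row k applied to `a`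
  -- leaves the shifted sequence.
  telescope : ∀ k → row Binv k a + row Binv (suc k) a ≡ row Binv k (a ∘ suc)
  telescope k = begin
    row Binv k a + row Binv (suc k) a                                   ≡⟨ cong (_+_ (row Binv k a)) (row-suc Binv-Pascal k a) ⟩
    row Binv k a + row Binv k (λ j → a (suc j) + - (+ 1) * a j)         ≡⟨ sym (row-distrib-+ Binv k a (λ j → a (suc j) + - (+ 1) * a j)) ⟩
    row Binv k (λ j → a j + (a (suc j) + - (+ 1) * a j))                ≡⟨ row-cong Binv k (λ j → cancel (a j) (a (suc j))) ⟩
    row Binv k (a ∘ suc)                                                ∎

-- Increasing subsequences

<ᵇ-true : ∀ {m n} → m < n → (m <ᵇ n) ≡ true
<ᵇ-true m<n = to T-≡ (ℕ.<⇒<ᵇ m<n)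

<ᵇ-false : ∀ {m n} → n ≤ m → (m <ᵇ n) ≡ false
<ᵇ-false {m} {n} n≤m with m <ᵇ n in eq
... | false = refl
... | true  = ⊥-elim (ℕ.<⇒≱ (ℕ.<ᵇ⇒< m n (from T-≡ eq)) n≤m)

-- above a x π sums a |s| over the increasing subsequences s of π (the empty one included)
-- with all entries greater than x; total a π sums a (|s| - 1) over the nonempty ones.
above : (ℕ → ℤ) → ℕ → List ℕ → ℤ
above a x []      = a 0
above a x (y ∷ π) = above a x π + (if x <ᵇ y then above (a ∘ suc) y π else + 0)

total : (ℕ → ℤ) → List ℕ → ℤ
total a []      = + 0
total a (x ∷ π) = total a π + above a x π

count : {X : Set} → (X → Bool) → List X → ℕ
count p xs = length (filter (λ s → p s ≟ᵇ true) xs)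

count-++ : ∀ {X : Set} (p : X → Bool) xs ys → count p (xs ++ ys) ≡ count p xs ℕ.+ count p ys
count-++ p xs ys = trans (cong length (filter-++ (λ s → p s ≟ᵇ true) xs ys)) (length-++ (filter (λ s → p s ≟ᵇ true) xs))

count-map : ∀ {X Y : Set} (p : Y → Bool) (f : X → Y) xs → count p (map f xs) ≡ count (p ∘ f) xs
count-map p f [] = refl
count-map p f (x ∷ xs) with p (f x)
... | true  = cong suc (count-map p f xs)
... | false = count-map p f xs

count-cong : ∀ {X : Set} {p q : X → Bool} → (∀ x → p x ≡ q x) → ∀ xs → count p xs ≡ count q xs
count-cong p≗q [] = refl
count-cong {p = p} {q} p≗q (x ∷ xs) with p x | q x | p≗q x
... | true  | _ | refl = cong suc (count-cong p≗q xs)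
... | false | _ | refl = count-cong p≗q xs

count-false : ∀ {X : Set} (xs : List X) → count (λ _ → false) xs ≡ 0
count-false [] = refl
count-false (x ∷ xs) = count-false xs

ε : ℕ → ℕ → List ℕ → ℕ
ε x k π = count (λ s → (length s ≡ᵇ k) ∧ increasing (x ∷ s)) (subseqs π)

τ-∷ : ∀ k x π → τ (suc k) (x ∷ π) ≡ ε x k π ℕ.+ τ (suc k) π
τ-∷ k x π = trans (count-++ _ (map (x ∷_) (subseqs π)) (subseqs π))
  (cong (ℕ._+ τ (suc k) π) (count-map _ (x ∷_) (subseqs π)))

ε-zero : ∀ x y π → ε x 0 (y ∷ π) ≡ ε x 0 π
ε-zero x y π = trans (count-++ _ (map (y ∷_) (subseqs π)) (subseqs π))
  (cong (ℕ._+ ε x 0 π) (trans (count-map _ (y ∷_) (subseqs π)) (count-false (subseqs π))))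

ε-suc : ∀ x k y π → ε x (suc k) (y ∷ π) ≡ (if x <ᵇ y then ε y k π else 0) ℕ.+ ε x (suc k) π
ε-suc x k y π = trans (count-++ _ (map (y ∷_) (subseqs π)) (subseqs π))
  (cong (ℕ._+ ε x (suc k) π) (trans (count-map _ (y ∷_) (subseqs π)) starting))
  where
  starting : count (λ s → (length s ≡ᵇ k) ∧ ((x <ᵇ y) ∧ increasing (y ∷ s))) (subseqs π)
           ≡ (if x <ᵇ y then ε y k π else 0)
  starting with x <ᵇ y
  ... | true  = refl
  ... | false = trans (count-cong (λ s → ∧-zeroʳ (length s ≡ᵇ k)) (subseqs π)) (count-false (subseqs π))

-- Lengths 0 to |π| occur, so any m beyond |π| captures all of them. The bound is left free because
-- subsequences through `y` use up one index of the sum and the others do not.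
above-ε : ∀ π x a m → length π < m → ∑ m (λ k → a k * + ε x k π) ≡ above a x π
above-ε [] x a (suc m) _ = begin
  a 0 * + 1 + ∑ m (λ k → a (suc k) * + 0)  ≡⟨ cong₂ _+_ (ℤ.*-identityʳ (a 0)) (∑-zero m (λ k → ℤ.*-zeroʳ (a (suc k)))) ⟩
  a 0 + + 0                                ≡⟨ ℤ.+-identityʳ (a 0) ⟩
  a 0                                      ∎
  where open ≡-Reasoning
above-ε (y ∷ π) x a (suc m) (s≤s π<m) = begin
  a 0 * + ε x 0 (y ∷ π) + ∑ m (λ k → a (suc k) * + ε x (suc k) (y ∷ π))
    ≡⟨ cong₂ _+_ (cong (λ z → a 0 * + z) (ε-zero x y π)) (∑-cong m λ k → trans (cong (λ z → a (suc k) * + z) (ε-suc x k y π)) (ℤ.*-distribˡ-+ (a (suc k)) (+ from-y k) (+ ε x (suc k) π))) ⟩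
  a 0 * + ε x 0 π + ∑ m (λ k → a (suc k) * + from-y k + a (suc k) * + ε x (suc k) π)
    ≡⟨ cong (_+_ (a 0 * + ε x 0 π)) (∑-distrib-+ m (λ k → a (suc k) * + from-y k) (λ k → a (suc k) * + ε x (suc k) π)) ⟩
  a 0 * + ε x 0 π + (∑ m (λ k → a (suc k) * + from-y k) + ∑ m (λ k → a (suc k) * + ε x (suc k) π))
    ≡⟨ rotate (a 0 * + ε x 0 π) (∑ m (λ k → a (suc k) * + from-y k)) (∑ m (λ k → a (suc k) * + ε x (suc k) π)) ⟩
  ∑ (suc m) (λ k → a k * + ε x k π) + ∑ m (λ k → a (suc k) * + from-y k)
    ≡⟨ cong₂ _+_ (above-ε π x a (suc m) (ℕ.m<n⇒m<1+n π<m)) through-y ⟩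
  above a x π + (if x <ᵇ y then above (a ∘ suc) y π else + 0) ∎
  where
  open ≡-Reasoning
  from-y : ℕ → ℕ
  from-y k = if x <ᵇ y then ε y k π else 0
  rotate : ∀ p q r → p + (q + r) ≡ p + r + q
  rotate = solve-∀
  through-y : ∑ m (λ k → a (suc k) * + from-y k) ≡ (if x <ᵇ y then above (a ∘ suc) y π else + 0)
  through-y with x <ᵇ y
  ... | true  = above-ε π y (a ∘ suc) m π<m
  ... | false = ∑-zero m (λ k → ℤ.*-zeroʳ (a (suc k)))

total-τ : ∀ π a m → length π ≤ m → ∑ m (λ k → a k * + τ (suc k) π) ≡ total a π
total-τ []      a m _ = ∑-zero m (λ k → ℤ.*-zeroʳ (a k))
total-τ (x ∷ π) a m π<m = begin
  ∑ m (λ k → a k * + τ (suc k) (x ∷ π))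
    ≡⟨ ∑-cong m (λ k → trans (cong (λ z → a k * + z) (τ-∷ k x π)) (ℤ.*-distribˡ-+ (a k) (+ ε x k π) (+ τ (suc k) π))) ⟩
  ∑ m (λ k → a k * + ε x k π + a k * + τ (suc k) π)
    ≡⟨ ∑-distrib-+ m (λ k → a k * + ε x k π) (λ k → a k * + τ (suc k) π) ⟩
  ∑ m (λ k → a k * + ε x k π) + ∑ m (λ k → a k * + τ (suc k) π)
    ≡⟨ cong₂ _+_ (above-ε π x a m π<m) (total-τ π a m (ℕ.<⇒≤ π<m)) ⟩
  above a x π + total a π
    ≡⟨ ℤ.+-comm (above a x π) (total a π) ⟩
  total a π + above a x π ∎
  where open ≡-Reasoning

col : Matrix → ℕ → ℕ → ℤ
col A n k = A k n

weight-total : ∀ A π n → weight A π n ≡ total (col A n) π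
weight-total A π n = trans (cong sumℤ (map-upTo (λ k → A k n * + τ (suc k) π) (length π)))
  (total-τ π (col A n) (length π) ℕ.≤-refl)

-- Increasing subsequences of relabelled words and of words K · max · R

module _ (f : ℕ → ℕ) (f-mono : ∀ x y → (f x <ᵇ f y) ≡ (x <ᵇ y)) where

  above-map : ∀ a x π → above a (f x) (map f π) ≡ above a x π
  above-map a x []      = refl
  above-map a x (y ∷ π) rewrite f-mono x y | above-map a x π | above-map (a ∘ suc) y π = refl

  total-map : ∀ a π → total a (map f π) ≡ total a π
  total-map a []      = refl
  total-map a (x ∷ π) = cong₂ _+_ (total-map a π) (above-map a x π)

above-max : ∀ a x R → All (_≤ x) R → above a x R ≡ a 0
above-max a x []      []          = refl
above-max a x (y ∷ R) (y≤x ∷ R≤x) rewrite <ᵇ-false y≤x | above-max a x R R≤x = ℤ.+-identityʳ (a 0)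

total-max : ∀ a t R → All (_≤ t) R → total a (t ∷ R) ≡ a 0 + total a R
total-max a t R R≤t = trans (cong (_+_ (total a R)) (above-max a t R R≤t)) (ℤ.+-comm (total a R) (a 0))

module _ {t : ℕ} {R : List ℕ} (R≤t : All (_≤ t) R) where

  -- As no entry of `R` exceeds `x`, the subsequences counted stay in K · t, and each of those
  -- inside `K` can be continued by `t` or not. This yields `up a`.
  above-++-large : ∀ a x K → All (_≤ x) R → x < t → All (_< t) K →
                   above a x (K ++ t ∷ R) ≡ above (up a) x K
  above-++-large a x [] R≤x x<t [] rewrite <ᵇ-true x<t =
    cong₂ _+_ (above-max a x R R≤x) (above-max (a ∘ suc) t R R≤t)
  above-++-large a x (y ∷ K) R≤x x<t (y<t ∷ K<t) with x <ᵇ y in eq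
  ... | false = cong (_+ + 0) (above-++-large a x K R≤x x<t K<t)
  ... | true  = cong₂ _+_ (above-++-large a x K R≤x x<t K<t)
                          (above-++-large (a ∘ suc) y K (All.map (λ r≤x → ℕ.≤-trans r≤x (ℕ.<⇒≤ x<y)) R≤x) y<t K<t)
    where x<y = ℕ.<ᵇ⇒< x y (from T-≡ eq)

  -- Every entry of `K` dominates `R`, so a subsequence above `x` lies in K · t or in `R`. The empty
  -- one lies in both, which explains the extra `a 0` on the left.
  above-++ : ∀ a x K → x < t → All (_< t) K → All (λ y → All (_≤ y) R) K →
             above a x (K ++ t ∷ R) + a 0 ≡ above (up a) x K + above a x R
  above-++ a x [] x<t [] [] rewrite <ᵇ-true x<t | above-max (a ∘ suc) t R R≤t = rotate (above a x R) (a 1) (a 0)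
    where
    rotate : ∀ p q r → p + q + r ≡ r + q + p
    rotate = solve-∀
  above-++ a x (y ∷ K) x<t (y<t ∷ K<t) (R≤y ∷ R≤K) = begin
    above a x (K ++ t ∷ R) + through-y + a 0        ≡⟨ swapʳ (above a x (K ++ t ∷ R)) through-y (a 0) ⟩
    above a x (K ++ t ∷ R) + a 0 + through-y        ≡⟨ cong₂ _+_ (above-++ a x K x<t K<t R≤K) through-y≡ ⟩
    above (up a) x K + above a x R + through-y′     ≡⟨ swapʳ (above (up a) x K) (above a x R) through-y′ ⟩
    above (up a) x K + through-y′ + above a x R     ∎
    where
    open ≡-Reasoning
    swapʳ : ∀ p q r → p + q + r ≡ p + r + q
    swapʳ = solve-∀
    through-y through-y′ : ℤ
    through-y  = if x <ᵇ y then above (a ∘ suc) y (K ++ t ∷ R) else + 0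
    through-y′ = if x <ᵇ y then above (up (a ∘ suc)) y K else + 0
    through-y≡ : through-y ≡ through-y′
    through-y≡ = cong (if x <ᵇ y then_else + 0) (above-++-large (a ∘ suc) y K R≤y y<t K<t)

  -- Again nothing passes from `K` or `t` into `R`. The term `a 0` is the singleton `t`, which does
  -- not extend a nonempty subsequence of `K`.
  total-++-large : ∀ a K → All (_< t) K → All (λ y → All (_≤ y) R) K →
                   total a (K ++ t ∷ R) ≡ total (up a) K + a 0 + total a R
  total-++-large a [] [] [] = trans (total-max a t R R≤t) (cong (_+ total a R) (sym (ℤ.+-identityˡ (a 0))))
  total-++-large a (y ∷ K) (y<t ∷ K<t) (R≤y ∷ R≤K) = begin
    total a (K ++ t ∷ R) + above a y (K ++ t ∷ R)                ≡⟨ cong₂ _+_ (total-++-large a K K<t R≤K) (above-++-large a y K R≤y y<t K<t) ⟩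
    total (up a) K + a 0 + total a R + above (up a) y K          ≡⟨ rotate (total (up a) K) (a 0) (total a R) (above (up a) y K) ⟩
    total (up a) K + above (up a) y K + a 0 + total a R          ∎
    where
    open ≡-Reasoning
    rotate : ∀ p q r s → p + q + r + s ≡ p + s + q + r
    rotate = solve-∀

  -- Only `m` can be followed by entries of `R`, so every increasing subsequence lies in K · t or in
  -- m · R. The singleton `t`, missed by `total (up a) K`, is balanced by the singleton `m`, which
  -- both terms on the right count. The induction runs through `K` up to the position of `m`.
  total-++ : ∀ a m K → Unique K → m ∈ K → All (_< t) K → (∀ {y} → y ∈ K → y ≢ m → All (_≤ y) R) →
             total a (K ++ t ∷ R) ≡ total (up a) K + total a (m ∷ R)
  -- Once `m` is reached, the remaining entries of `K` all dominate `R`, and only the subsequences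
  -- starting with `m` need the finer count `above-++`.
  total-++ a m (m ∷ K) (m∉K ∷ _) (here refl) (m<t ∷ K<t) R≤ = begin
    total a (K ++ t ∷ R) + above a m (K ++ t ∷ R)
      ≡⟨ cong (_+ above a m (K ++ t ∷ R)) (total-++-large a K K<t R≤K) ⟩
    total (up a) K + a 0 + total a R + above a m (K ++ t ∷ R)
      ≡⟨ rotate (total (up a) K) (a 0) (total a R) (above a m (K ++ t ∷ R)) ⟩
    total (up a) K + total a R + (above a m (K ++ t ∷ R) + a 0)
      ≡⟨ cong (_+_ (total (up a) K + total a R)) (above-++ a m K m<t K<t R≤K) ⟩
    total (up a) K + total a R + (above (up a) m K + above a m R)
      ≡⟨ exchange (total (up a) K) (total a R) (above (up a) m K) (above a m R) ⟩
    total (up a) K + above (up a) m K + (total a R + above a m R) ∎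
    where
    open ≡-Reasoning
    R≤K : All (λ y → All (_≤ y) R) K
    R≤K = All.tabulate (λ y∈K → R≤ (there y∈K) (All.lookup m∉K y∈K ∘ sym))
    rotate : ∀ p q r s → p + q + r + s ≡ p + r + (s + q)
    rotate = solve-∀
    exchange : ∀ p q r s → p + q + (r + s) ≡ p + r + (q + s)
    exchange = solve-∀
  total-++ a m (y ∷ K) (y∉K ∷ K!) (there m∈K) (y<t ∷ K<t) R≤ = begin
    total a (K ++ t ∷ R) + above a y (K ++ t ∷ R)            ≡⟨ cong₂ _+_ (total-++ a m K K! m∈K K<t (R≤ ∘ there))
                                                                       (above-++-large a y K (R≤ (here refl) (All.lookup y∉K m∈K)) y<t K<t) ⟩
    total (up a) K + total a (m ∷ R) + above (up a) y K      ≡⟨ swapʳ (total (up a) K) (total a (m ∷ R)) (above (up a) y K) ⟩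
    total (up a) K + above (up a) y K + total a (m ∷ R)      ∎
    where
    open ≡-Reasoning
    swapʳ : ∀ p q r → p + q + r ≡ p + r + q
    swapʳ = solve-∀

-- Permutations avoiding 1243 and 2143

-- The patterns 1243 and 2143 differ only in the order of their first two letters. Leaving the order
-- of `a` and `b` open forbids both at once.
Avoids : List ℕ → Set
Avoids π = ∀ {a b d c} → a ∷ b ∷ d ∷ c ∷ [] ⊆ π → a < c → b < c → c < d → ⊥

record Avoider (n : ℕ) (π : List ℕ) : Set where
  constructor mkAvoider
  field
    len    : length π ≡ n
    bound  : All (_< n) π
    unique : Unique π
    avoid  : Avoids π
open Avoider

-- The Boolean tests for patterns and permutations

subseqs⁺ : ∀ {s π} → s ⊆ π → s ∈ subseqs π
subseqs⁺ []         = here refl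
subseqs⁺ (x ∷ʳ s⊆π) = ∈-++⁺ʳ (map (x ∷_) _) (subseqs⁺ s⊆π)
subseqs⁺ (refl ∷ s⊆π) = ∈-++⁺ˡ (∈-map⁺ (_ ∷_) (subseqs⁺ s⊆π))

subseqs⁻ : ∀ π {s} → s ∈ subseqs π → s ⊆ π
subseqs⁻ []      (here refl) = []
subseqs⁻ (x ∷ π) s∈ with ∈-++⁻ (map (x ∷_) (subseqs π)) s∈
... | inj₂ s∈π = x ∷ʳ subseqs⁻ π s∈π
... | inj₁ xs∈ with ∈-map⁻ (x ∷_) xs∈
...   | s , s∈π , refl = refl ∷ subseqs⁻ π s∈π

contains⁺ : ∀ {σ π s} → s ⊆ π → length s ≡ length σ → T (sameOrder s σ) → T (contains σ π)
contains⁺ {σ} {π} {s} s⊆π len≡ ord =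
  Any.any⁺ _ (Any.map (λ { refl → from T-∧ (ℕ.≡⇒≡ᵇ (length s) (length σ) len≡ , ord) }) (subseqs⁺ s⊆π))

contains⁻ : ∀ {σ π} → T (contains σ π) → ∃[ s ] s ⊆ π × length s ≡ length σ × T (sameOrder s σ)
contains⁻ {σ} {π} h with find (Any.any⁻ _ (subseqs π) h)
... | s , s∈ , hs with to (T-∧ {length s ≡ᵇ length σ}) hs
...   | len≡ , ord = s , subseqs⁻ π s∈ , ℕ.≡ᵇ⇒≡ (length s) (length σ) len≡ , ord

SameOrder : List ℕ → List ℕ → Set
SameOrder s σ = All (λ p → All (λ q → T (beq (proj₁ p <ᵇ proj₁ q) (proj₂ p <ᵇ proj₂ q))) (zip s σ)) (zip s σ)

sameOrder⁺ : ∀ {s σ} → SameOrder s σ → T (sameOrder s σ)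
sameOrder⁺ = All.all⁻ _ ∘ All.map (All.all⁻ _)

sameOrder⁻ : ∀ {s σ} → T (sameOrder s σ) → SameOrder s σ
sameOrder⁻ = All.map (All.all⁺ _ _) ∘ All.all⁺ _ _

beq-true⁺ : ∀ {m n} → m < n → T (beq (m <ᵇ n) true)
beq-true⁺ m<n rewrite <ᵇ-true m<n = _

beq-true⁻ : ∀ {m n} → T (beq (m <ᵇ n) true) → m < n
beq-true⁻ {m} {n} h with m <ᵇ n in eq
... | true = ℕ.<ᵇ⇒< m n (from T-≡ eq)

beq-false⁺ : ∀ {m n} → n ≤ m → T (beq (m <ᵇ n) false)
beq-false⁺ n≤m rewrite <ᵇ-false n≤m = _

beq-refl⁺ : ∀ m → T (beq (m <ᵇ m) false)
beq-refl⁺ m = beq-false⁺ {m} ℕ.≤-refl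

sameOrder-1243 : ∀ {a b d c} → a < b → b < c → c < d → SameOrder (a ∷ b ∷ d ∷ c ∷ []) p1243
sameOrder-1243 {a} {b} {d} {c} a<b b<c c<d =
    (beq-refl⁺ a ∷ beq-true⁺ a<b ∷ beq-true⁺ a<d ∷ beq-true⁺ a<c ∷ [])
  ∷ (beq-false⁺ (ℕ.<⇒≤ a<b) ∷ beq-refl⁺ b ∷ beq-true⁺ b<d ∷ beq-true⁺ b<c ∷ [])
  ∷ (beq-false⁺ (ℕ.<⇒≤ a<d) ∷ beq-false⁺ (ℕ.<⇒≤ b<d) ∷ beq-refl⁺ d ∷ beq-false⁺ (ℕ.<⇒≤ c<d) ∷ [])
  ∷ (beq-false⁺ (ℕ.<⇒≤ a<c) ∷ beq-false⁺ (ℕ.<⇒≤ b<c) ∷ beq-true⁺ c<d ∷ beq-refl⁺ c ∷ [])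
  ∷ []
  where
  a<c = ℕ.<-trans a<b b<c
  b<d = ℕ.<-trans b<c c<d
  a<d = ℕ.<-trans a<c c<d

sameOrder-2143 : ∀ {a b d c} → b < a → a < c → c < d → SameOrder (a ∷ b ∷ d ∷ c ∷ []) p2143
sameOrder-2143 {a} {b} {d} {c} b<a a<c c<d =
    (beq-refl⁺ a ∷ beq-false⁺ (ℕ.<⇒≤ b<a) ∷ beq-true⁺ a<d ∷ beq-true⁺ a<c ∷ [])
  ∷ (beq-true⁺ b<a ∷ beq-refl⁺ b ∷ beq-true⁺ b<d ∷ beq-true⁺ b<c ∷ [])
  ∷ (beq-false⁺ (ℕ.<⇒≤ a<d) ∷ beq-false⁺ (ℕ.<⇒≤ b<d) ∷ beq-refl⁺ d ∷ beq-false⁺ (ℕ.<⇒≤ c<d) ∷ [])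
  ∷ (beq-false⁺ (ℕ.<⇒≤ a<c) ∷ beq-false⁺ (ℕ.<⇒≤ b<c) ∷ beq-true⁺ c<d ∷ beq-refl⁺ c ∷ [])
  ∷ []
  where
  b<c = ℕ.<-trans b<a a<c
  a<d = ℕ.<-trans a<c c<d
  b<d = ℕ.<-trans b<c c<d

⊆-unique-pair : ∀ {a b : ℕ} {cs π} → Unique π → a ∷ b ∷ cs ⊆ π → a ≢ b
⊆-unique-pair (_ ∷ π!)   (_ ∷ʳ s⊆π)  = ⊆-unique-pair π! s⊆π
⊆-unique-pair (a∉π ∷ _) (refl ∷ s⊆π) = All.lookup a∉π (lookup s⊆π (here refl))

¬T⇒false : ∀ {b} → ¬ T b → b ≡ false
¬T⇒false {false} _  = refl
¬T⇒false {true}  ¬t = ⊥-elim (¬t _)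

avoids⁺ : ∀ {π} → Avoids π → T (avoids π)
avoids⁺ {π} av = from T-∧ (from T-not-≡ (¬T⇒false avoid-1243) , from T-not-≡ (¬T⇒false avoid-2143))
  where
  avoid-1243 : T (contains p1243 π) → ⊥
  avoid-1243 h with contains⁻ {p1243} {π} h
  ... | a ∷ b ∷ d ∷ c ∷ [] , s⊆π , _ , ord with sameOrder⁻ {a ∷ b ∷ d ∷ c ∷ []} {p1243} ord
  ...   | (_ ∷ _ ∷ _ ∷ ac ∷ []) ∷ (_ ∷ _ ∷ _ ∷ bc ∷ []) ∷ _ ∷ (_ ∷ _ ∷ cd ∷ _ ∷ []) ∷ [] =
    av s⊆π (beq-true⁻ ac) (beq-true⁻ bc) (beq-true⁻ cd)
  avoid-2143 : T (contains p2143 π) → ⊥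
  avoid-2143 h with contains⁻ {p2143} {π} h
  ... | a ∷ b ∷ d ∷ c ∷ [] , s⊆π , _ , ord with sameOrder⁻ {a ∷ b ∷ d ∷ c ∷ []} {p2143} ord
  ...   | (_ ∷ _ ∷ _ ∷ ac ∷ []) ∷ (_ ∷ _ ∷ _ ∷ bc ∷ []) ∷ _ ∷ (_ ∷ _ ∷ cd ∷ _ ∷ []) ∷ [] =
    av s⊆π (beq-true⁻ ac) (beq-true⁻ bc) (beq-true⁻ cd)

-- Trichotomy on the first two letters decides which of the two patterns occurs; equality is
-- excluded because the entries are distinct.
avoids⁻ : ∀ {π} → Unique π → T (avoids π) → Avoids π
avoids⁻ {π} π! h {a} {b} {d} {c} s⊆π a<c b<c c<d with to (T-∧ {not (contains p1243 π)}) h | ℕ.<-cmp a b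
... | no-1243 , no-2143 | tri< a<b _ _ =
  subst T (to T-not-≡ no-1243) (contains⁺ {p1243} {π} s⊆π refl (sameOrder⁺ {a ∷ b ∷ d ∷ c ∷ []} {p1243} (sameOrder-1243 a<b b<c c<d)))
... | no-1243 , no-2143 | tri≈ _ a≡b _ = ⊆-unique-pair π! s⊆π a≡b
... | no-1243 , no-2143 | tri> _ _ b<a =
  subst T (to T-not-≡ no-2143) (contains⁺ {p2143} {π} s⊆π refl (sameOrder⁺ {a ∷ b ∷ d ∷ c ∷ []} {p2143} (sameOrder-2143 b<a a<c c<d)))

notIn⁺ : ∀ {x xs} → All (x ≢_) xs → T (notIn x xs)
notIn⁺ {x} = All.all⁻ _ ∘ All.map (λ {y} x≢y → from T-not-≡ (¬T⇒false (x≢y ∘ ℕ.≡ᵇ⇒≡ x y)))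

notIn⁻ : ∀ {x xs} → T (notIn x xs) → All (x ≢_) xs
notIn⁻ {x} {xs} = All.map (λ {y} h x≡y → subst T (to (T-not-≡ {x ≡ᵇ y}) h) (ℕ.≡⇒≡ᵇ x y x≡y)) ∘ All.all⁺ _ xs

distinct⁺ : ∀ {xs} → Unique xs → T (distinct xs)
distinct⁺ []         = _
distinct⁺ (x∉ ∷ xs!) = from T-∧ (notIn⁺ x∉ , distinct⁺ xs!)

distinct⁻ : ∀ xs → T (distinct xs) → Unique xs
distinct⁻ []       _ = []
distinct⁻ (x ∷ xs) h with to (T-∧ {notIn x xs}) h
... | x∉ , xs! = notIn⁻ x∉ ∷ distinct⁻ xs xs!

∈-words⁺ : ∀ {k w} → All (_< k) w → w ∈ words (length w) k
∈-words⁺ []          = here refl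
∈-words⁺ (x<k ∷ w<k) = ∈-concatMap⁺ _ (lose (∈-upTo⁺ x<k) (∈-map⁺ _ (∈-words⁺ w<k)))

∈-words⁻ : ∀ n {k w} → w ∈ words n k → length w ≡ n × All (_< k) w
∈-words⁻ zero    (here refl) = refl , []
∈-words⁻ (suc n) {k} w∈ with find (∈-concatMap⁻ (λ x → map (x ∷_) (words n k)) {upTo k} w∈)
... | x , x∈ , xw∈ with ∈-map⁻ (x ∷_) xw∈
...   | w , w∈′ , refl with ∈-words⁻ n w∈′
...     | refl , w<k = refl , ∈-upTo⁻ x∈ ∷ w<k

∈-avoiders⁺ : ∀ {n π} → Avoider n π → π ∈ avoiders n
∈-avoiders⁺ (mkAvoider refl π<n π! av) =
  ∈-filter⁺ (λ π → avoids π ≟ᵇ true) (∈-filter⁺ (λ w → distinct w ≟ᵇ true) (∈-words⁺ π<n) (to T-≡ (distinct⁺ π!))) (to T-≡ (avoids⁺ av))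

∈-avoiders⁻ : ∀ {n π} → π ∈ avoiders n → Avoider n π
∈-avoiders⁻ {n} {π} π∈ with ∈-filter⁻ (λ π → avoids π ≟ᵇ true) {xs = perms n} π∈
... | π∈perms , av with ∈-filter⁻ (λ w → distinct w ≟ᵇ true) {xs = words n n} π∈perms
...   | π∈words , π! with ∈-words⁻ n π∈words
...     | len≡ , π<n = mkAvoider len≡ π<n π!′ (avoids⁻ π!′ (from T-≡ av))
  where π!′ = distinct⁻ π (from T-≡ π!)

-- Lists without repetitions and the pigeonhole principle

module _ {X Y : Set} where

  map-unique : ∀ {f : X → Y} {xs} → (∀ {x y} → x ∈ xs → y ∈ xs → f x ≡ f y → x ≡ y) →
               Unique xs → Unique (map f xs)
  map-unique inj []         = []
  map-unique inj (x∉ ∷ xs!) =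
    All.map⁺ (All.tabulate λ y∈ → All.lookup x∉ y∈ ∘ inj (here refl) (there y∈)) ∷ map-unique (λ x∈ y∈ → inj (there x∈) (there y∈)) xs!

  -- An element of a block `f x` determines `x`, so blocks belonging to different arguments are
  -- disjoint.
  concatMap-unique : ∀ {f : X → List Y} {xs} → (∀ x → Unique (f x)) →
                     (∀ {x y z} → z ∈ f x → z ∈ f y → x ≡ y) → Unique xs → Unique (concatMap f xs)
  concatMap-unique f! inj []         = []
  concatMap-unique {f} {x ∷ xs} f! inj (x∉ ∷ xs!) =
    Unique.++⁺ (f! x) (concatMap-unique f! inj xs!) λ { (z∈ , z∈′) → disjoint z∈ (find (∈-concatMap⁻ f {xs} z∈′)) }
    where
    disjoint : ∀ {z} → z ∈ f x → ∃[ y ] y ∈ xs × z ∈ f y → ⊥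
    disjoint z∈ (y , y∈ , z∈y) = All.lookup x∉ y∈ (inj z∈ z∈y)

words-unique : ∀ n k → Unique (words n k)
words-unique zero    k = [] ∷ []
words-unique (suc n) k = concatMap-unique
  (λ x → Unique.map⁺ ∷-injectiveʳ (words-unique n k)) same-head (Unique.upTo⁺ k)
  where
  same-head : ∀ {x y z} → z ∈ map (x ∷_) (words n k) → z ∈ map (y ∷_) (words n k) → x ≡ y
  same-head z∈ z∈′ with ∈-map⁻ _ z∈ | ∈-map⁻ _ z∈′
  ... | _ , _ , refl | _ , _ , refl = refl

avoiders-unique : ∀ n → Unique (avoiders n)
avoiders-unique n = Unique.filter⁺ (λ π → avoids π ≟ᵇ true) (Unique.filter⁺ (λ w → distinct w ≟ᵇ true) (words-unique n n))

length-unique-≤ : ∀ {xs ys : List ℕ} → Unique xs → (∀ {x} → x ∈ xs → x ∈ ys) → length xs ≤ length ys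
length-unique-≤ [] _ = z≤n
length-unique-≤ {x ∷ xs} (x∉ ∷ xs!) sub with ∈-∃++ (sub (here refl))
... | as , bs , refl = ℕ.≤-trans (s≤s (length-unique-≤ xs! sub′)) (ℕ.≤-reflexive lengths)
  where
  sub′ : ∀ {y} → y ∈ xs → y ∈ as ++ bs
  sub′ y∈ with ∈-++⁻ as (sub (there y∈))
  ... | inj₁ y∈as          = ∈-++⁺ˡ y∈as
  ... | inj₂ (here refl)   = ⊥-elim (All.lookup x∉ y∈ refl)
  ... | inj₂ (there y∈bs)  = ∈-++⁺ʳ as y∈bs
  lengths : suc (length (as ++ bs)) ≡ length (as ++ x ∷ bs)
  lengths = trans (cong suc (length-++ as)) (trans (sym (ℕ.+-suc (length as) (length bs))) (sym (length-++ as)))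

length-bounded-≤ : ∀ {n xs} → Unique xs → All (_< n) xs → length xs ≤ n
length-bounded-≤ {n} {xs} xs! xs<n = subst (length xs ≤_) (length-upTo n)
  (length-unique-≤ xs! (∈-upTo⁺ ∘ All.lookup xs<n))

-- If `x` were missing, adding it would give n + 1 distinct values below n. So an `Avoider` takes
-- every value below its length, although its definition asks only for distinct bounded entries.
full : ∀ {n xs x} → Unique xs → All (_< n) xs → length xs ≡ n → x < n → x ∈ xs
full {n} {xs} {x} xs! xs<n len≡ x<n with x ∈? xs
... | yes x∈ = x∈
... | no  x∉ = ⊥-elim (ℕ.<⇒≱ (s≤s (ℕ.≤-reflexive (sym len≡)))
                 (length-bounded-≤ (All.¬Any⇒All¬ xs x∉ ∷ xs!) (x<n ∷ xs<n)))

-- Gluing two avoiders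

-- In a gluing, r is the length of `R`, so σ = s R occupies the values 0 to r. The positive values
-- of L therefore start again at r + 1.
relabel : ℕ → ℕ → ℕ → ℕ
relabel s r zero    = s
relabel s r (suc v) = suc v ℕ.+ r

-- The least value 0 of L becomes the first entry s of σ, and the other values of L are moved
-- above all entries of R; the value at σ = [] is junk.
glue : List ℕ → List ℕ → List ℕ
glue L []      = L
glue L (s ∷ R) = map (relabel s (length R)) L ++ (length L ℕ.+ length R) ∷ R

++-⊆⁻ : ∀ {X : Set} (xs : List X) {ys zs} → zs ⊆ xs ++ ys → ∃₂ λ as bs → zs ≡ as ++ bs × as ⊆ xs × bs ⊆ ys
++-⊆⁻ []       zs⊆ = [] , _ , refl , [] , zs⊆
++-⊆⁻ (x ∷ xs) (_ ∷ʳ zs⊆) with ++-⊆⁻ xs zs⊆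
... | as , bs , eq , as⊆ , bs⊆ = as , bs , eq , x ∷ʳ as⊆ , bs⊆
++-⊆⁻ (x ∷ xs) (refl ∷ zs⊆) with ++-⊆⁻ xs zs⊆
... | as , bs , eq , as⊆ , bs⊆ = x ∷ as , bs , cong (x ∷_) eq , refl ∷ as⊆ , bs⊆

map-⊆⁻ : ∀ {X Y : Set} (f : X → Y) xs {ys} → ys ⊆ map f xs → ∃[ zs ] ys ≡ map f zs × zs ⊆ xs
map-⊆⁻ f []       []         = [] , refl , []
map-⊆⁻ f (x ∷ xs) (_ ∷ʳ ys⊆) with map-⊆⁻ f xs ys⊆
... | zs , eq , zs⊆ = zs , eq , x ∷ʳ zs⊆
map-⊆⁻ f (x ∷ xs) (refl ∷ ys⊆) with map-⊆⁻ f xs ys⊆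
... | zs , eq , zs⊆ = x ∷ zs , cong (f x ∷_) eq , refl ∷ zs⊆

⊆-pair : ∀ {x y : ℕ} {xs} → x ∈ xs → y ∈ xs → x ≢ y → (x ∷ y ∷ [] ⊆ xs) ⊎ (y ∷ x ∷ [] ⊆ xs)
⊆-pair (here refl) (here refl) x≢y = ⊥-elim (x≢y refl)
⊆-pair (here refl) (there y∈)  x≢y = inj₁ (refl ∷ from∈ y∈)
⊆-pair (there x∈)  (here refl) x≢y = inj₂ (refl ∷ from∈ x∈)
⊆-pair (there x∈)  (there y∈)  x≢y with ⊆-pair x∈ y∈ x≢y
... | inj₁ p = inj₁ (_ ∷ʳ p)
... | inj₂ p = inj₂ (_ ∷ʳ p)

Avoids-⊆ : ∀ {π ρ} → π ⊆ ρ → Avoids ρ → Avoids π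
Avoids-⊆ π⊆ρ av s⊆π = av (⊆-trans s⊆π π⊆ρ)

module _ {f : ℕ → ℕ} (f-mono : ∀ {x y} → x < y → f x < f y) where

  mono-cancel-< : ∀ {x y} → f x < f y → x < y
  mono-cancel-< {x} {y} fx<fy with ℕ.<-cmp x y
  ... | tri< x<y _ _  = x<y
  ... | tri≈ _ refl _ = ⊥-elim (ℕ.<-irrefl refl fx<fy)
  ... | tri> _ _ y<x  = ⊥-elim (ℕ.<-asym fx<fy (f-mono y<x))

  mono-injective : ∀ {x y} → f x ≡ f y → x ≡ y
  mono-injective {x} {y} fx≡fy with ℕ.<-cmp x y
  ... | tri< x<y _ _ = ⊥-elim (ℕ.<-irrefl fx≡fy (f-mono x<y))
  ... | tri≈ _ x≡y _ = x≡y
  ... | tri> _ _ y<x = ⊥-elim (ℕ.<-irrefl (sym fx≡fy) (f-mono y<x))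

  mono-<ᵇ : ∀ x y → (f x <ᵇ f y) ≡ (x <ᵇ y)
  mono-<ᵇ x y with x <ᵇ y in eq
  ... | true  = <ᵇ-true (f-mono (ℕ.<ᵇ⇒< x y (from T-≡ eq)))
  ... | false = ¬T⇒false λ h → subst T eq (ℕ.<⇒<ᵇ (mono-cancel-< (ℕ.<ᵇ⇒< (f x) (f y) h)))

  Avoids-map⁺ : ∀ {π} → Avoids π → Avoids (map f π)
  Avoids-map⁺ {π} av s⊆ a<c b<c c<d with map-⊆⁻ f π s⊆
  ... | a ∷ b ∷ d ∷ c ∷ [] , refl , s⊆π = av s⊆π (mono-cancel-< a<c) (mono-cancel-< b<c) (mono-cancel-< c<d)

  Avoids-map⁻ : ∀ {π} → Avoids (map f π) → Avoids π
  Avoids-map⁻ av s⊆π a<c b<c c<d = av (map⁺ f s⊆π) (f-mono a<c) (f-mono b<c) (f-mono c<d)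

relabel-mono : ∀ {s r} → s ≤ r → ∀ {x y} → x < y → relabel s r x < relabel s r y
relabel-mono {s} {r} s≤r {zero}  {suc y} _   = s≤s (ℕ.≤-trans s≤r (ℕ.m≤n+m r y))
relabel-mono {s} {r} s≤r {suc x} {suc y} x<y = ℕ.+-monoˡ-< r x<y

-- Positive values land above r, so K meets the range 0 to r of σ only in `s`. The whole analysis of
-- gluing rests on this.
relabel-small : ∀ {s r} v → relabel s r v ≤ r → relabel s r v ≡ s
relabel-small zero        _ = refl
relabel-small {s} {r} (suc v) h = ⊥-elim (ℕ.<⇒≱ (s≤s (ℕ.m≤n+m r v)) h)

map-relabel-small : ∀ {s r} L {x} → x ∈ map (relabel s r) L → x ≤ r → x ≡ s
map-relabel-small {s} {r} L x∈ x≤r with ∈-map⁻ (relabel s r) x∈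
... | v , _ , refl = relabel-small v x≤r

relabel-< : ∀ {s r ℓ v} → s ≤ r → v < ℓ → relabel s r v < ℓ ℕ.+ r
relabel-< {s} {r} {ℓ} {zero}  s≤r v<ℓ = ℕ.+-mono-<-≤ v<ℓ s≤r
relabel-< {s} {r} {ℓ} {suc v} s≤r v<ℓ = ℕ.+-monoˡ-< r v<ℓ

module Glued {L s R} (0<ℓ : 0 < length L) (Lᴬ : Avoider (length L) L) (σᴬ : Avoider (suc (length R)) (s ∷ R)) where

  r top : ℕ
  r   = length R
  top = length L ℕ.+ r

  f : ℕ → ℕ
  f = relabel s r

  K : List ℕ
  K = map f L

  s≤r : s ≤ r
  s≤r = ℕ.s≤s⁻¹ (All.head (bound σᴬ))

  R≤r : All (_≤ r) R
  R≤r = All.map ℕ.s≤s⁻¹ (All.tail (bound σᴬ))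

  r<top : r < top
  r<top = ℕ.+-monoˡ-≤ r 0<ℓ

  K<top : All (_< top) K
  K<top = All.map⁺ (All.map (relabel-< s≤r) (bound Lᴬ))

  K! : Unique K
  K! = Unique.map⁺ (mono-injective (relabel-mono s≤r)) (unique Lᴬ)

  R≤top : All (_≤ top) R
  R≤top = All.map (λ c≤r → ℕ.≤-trans c≤r (ℕ.<⇒≤ r<top)) R≤r

  s∈K : s ∈ K
  s∈K = ∈-map⁺ f (full (unique Lᴬ) (bound Lᴬ) refl 0<ℓ)

  K-small : ∀ {x} → x ∈ K → x ≤ r → x ≡ s
  K-small = map-relabel-small L

  glue-Unique : Unique (glue L (s ∷ R))
  glue-Unique = Unique.++⁺ K! (All.map (λ c≤r top≡c → ℕ.<⇒≱ r<top (subst (_≤ r) (sym top≡c) c≤r)) R≤r ∷ AllPairs.tail (unique σᴬ)) disjoint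
    where
    disjoint : ∀ {v} → v ∈ K × v ∈ top ∷ R → ⊥
    disjoint (v∈K , here refl) = ℕ.<-irrefl refl (All.lookup K<top v∈K)
    disjoint (v∈K , there v∈R) = All.lookup (AllPairs.head (unique σᴬ)) v∈R (sym (K-small v∈K (All.lookup R≤r v∈R)))

  -- Split an occurrence a b d c between K and top · R. If it lies inside K, it comes from L. If c
  -- is in `R` and both a and b are in K, then both equal `s`, which is impossible. If only a is in
  -- K, then a is `s` and the occurrence lies in σ. The maximum can be neither a nor b, since these
  -- are below c, nor c, since c is below d; as d it falls under the case of two small entries of K.
  glue-Avoids : Avoids (glue L (s ∷ R))
  glue-Avoids {a} {b} {d} {c} abdc⊆ a<c b<c c<d with ++-⊆⁻ K abdc⊆
  ... | as , bs , eq , as⊆ , bs⊆ = cases as bs eq as⊆ bs⊆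
    where
    two-below : a ∷ b ∷ [] ⊆ K → c ≤ r → ⊥
    two-below ab⊆ c≤r = ⊆-unique-pair K! ab⊆
      (trans (K-small (lookup ab⊆ (here refl)) (ℕ.≤-trans (ℕ.<⇒≤ a<c) c≤r))
        (sym (K-small (lookup ab⊆ (there (here refl))) (ℕ.≤-trans (ℕ.<⇒≤ b<c) c≤r))))
    in-R : ∀ {cs} → cs ⊆ R → c ∈ cs → c ≤ r
    in-R cs⊆ c∈ = All.lookup R≤r (lookup cs⊆ c∈)
    cases : ∀ as bs → a ∷ b ∷ d ∷ c ∷ [] ≡ as ++ bs → as ⊆ K → bs ⊆ top ∷ R → ⊥
    cases [] _ refl _ (_ ∷ʳ bs⊆) = avoid σᴬ (s ∷ʳ bs⊆) a<c b<c c<d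
    cases [] _ refl _ (refl ∷ bs⊆) = ℕ.<⇒≱ r<top (ℕ.≤-trans (ℕ.<⇒≤ a<c) (in-R bs⊆ (there (there (here refl)))))
    cases (_ ∷ []) _ refl as⊆ (_ ∷ʳ bs⊆)
      with refl ← K-small (lookup as⊆ (here refl)) (ℕ.≤-trans (ℕ.<⇒≤ a<c) (in-R bs⊆ (there (there (here refl)))))
      = avoid σᴬ (refl ∷ bs⊆) a<c b<c c<d
    cases (_ ∷ []) _ refl as⊆ (refl ∷ bs⊆) = ℕ.<⇒≱ r<top (ℕ.≤-trans (ℕ.<⇒≤ b<c) (in-R bs⊆ (there (here refl))))
    cases (_ ∷ _ ∷ []) _ refl as⊆ (_ ∷ʳ bs⊆) = two-below as⊆ (in-R bs⊆ (there (here refl)))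
    cases (_ ∷ _ ∷ []) _ refl as⊆ (refl ∷ bs⊆) = two-below as⊆ (in-R bs⊆ (here refl))
    cases (_ ∷ _ ∷ _ ∷ []) _ refl as⊆ (_ ∷ʳ bs⊆) =
      two-below (⊆-trans (refl ∷ refl ∷ _ ∷ʳ []) as⊆) (in-R bs⊆ (here refl))
    cases (_ ∷ _ ∷ _ ∷ []) _ refl as⊆ (refl ∷ bs⊆) = ℕ.<-asym c<d (All.lookup K<top (lookup as⊆ (there (there (here refl)))))
    cases (_ ∷ _ ∷ _ ∷ _ ∷ []) [] refl as⊆ _ = Avoids-map⁺ (relabel-mono s≤r) (avoid Lᴬ) as⊆ a<c b<c c<d

  glue-Avoider : Avoider (length L ℕ.+ suc r) (glue L (s ∷ R))
  glue-Avoider = mkAvoider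
    (trans (length-++ K) (cong (ℕ._+ suc r) (length-map f L)))
    (subst (λ n → All (_< n) (glue L (s ∷ R))) (sym (ℕ.+-suc (length L) r))
      (All.++⁺ (All.map ℕ.m<n⇒m<1+n K<top) (ℕ.n<1+n top ∷ All.map s≤s R≤top)))
    glue-Unique
    glue-Avoids

  total-glue : ∀ a → total a (glue L (s ∷ R)) ≡ total (up a) L + total a (s ∷ R)
  total-glue a = trans
    (total-++ R≤top a s K K! s∈K K<top λ {y} y∈ y≢s → All.map (λ {c} c≤r → ℕ.≤-trans c≤r (ℕ.≰⇒≥ (λ y≤r → y≢s (K-small y∈ y≤r)))) R≤r)
    (cong (_+ total a (s ∷ R)) (total-map f (mono-<ᵇ (relabel-mono s≤r)) (up a) L))

-- Uniqueness of the two glued parts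

++-∷-injective : ∀ {t} (xs xs′ : List ℕ) {ys ys′} → t ∉ xs → t ∉ xs′ → xs ++ t ∷ ys ≡ xs′ ++ t ∷ ys′ → xs ≡ xs′ × ys ≡ ys′
++-∷-injective []       []         _  _   eq = refl , ∷-injectiveʳ eq
++-∷-injective []       (x′ ∷ xs′) _  t∉′ eq = ⊥-elim (t∉′ (here (∷-injectiveˡ eq)))
++-∷-injective (x ∷ xs) []         t∉ _   eq = ⊥-elim (t∉ (here (sym (∷-injectiveˡ eq))))
++-∷-injective (x ∷ xs) (x′ ∷ xs′) t∉ t∉′ eq with ∷-injective eq
... | refl , eq′ with ++-∷-injective xs xs′ (t∉ ∘ there) (t∉′ ∘ there) eq′
...   | refl , refl = refl , refl

map-injective : ∀ {f : ℕ → ℕ} → (∀ {x y} → f x ≡ f y → x ≡ y) → ∀ {xs ys} → map f xs ≡ map f ys → xs ≡ ys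
map-injective inj {[]}     {[]}     _  = refl
map-injective inj {x ∷ xs} {y ∷ ys} eq = cong₂ _∷_ (inj (∷-injectiveˡ eq)) (map-injective inj (∷-injectiveʳ eq))

-- The condition on the lengths makes the two maxima equal, and a maximum does not occur in K, so it
-- marks the cut and K and `R` are recovered. Then `s` is the only entry of K that is at most |R|,
-- and with `s` known the relabelling is a fixed injective map.
glue-injective : ∀ {i j i′ j′ L σ L′ σ′} → Avoider (suc i) L → Avoider (suc j) σ → Avoider (suc i′) L′ → Avoider (suc j′) σ′ →
                 i ℕ.+ j ≡ i′ ℕ.+ j′ → glue L σ ≡ glue L′ σ′ → L ≡ L′ × σ ≡ σ′
glue-injective {L = x ∷ L} {s ∷ R} {x′ ∷ L′} {s′ ∷ R′} Lᴬ@(mkAvoider refl _ _ _) σᴬ@(mkAvoider refl _ _ _) L′ᴬ@(mkAvoider refl _ _ _) σ′ᴬ@(mkAvoider refl _ _ _) tops eq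
  with ++-∷-injective G.K G′.K (λ t∈ → ℕ.<-irrefl refl (All.lookup G.K<top t∈))
         (λ t∈ → ℕ.<-irrefl (cong suc tops) (All.lookup G′.K<top t∈))
         (trans eq (cong (λ t → G′.K ++ t ∷ R′) (cong suc (sym tops))))
  where
  module G  = Glued (s≤s z≤n) Lᴬ σᴬ
  module G′ = Glued (s≤s z≤n) L′ᴬ σ′ᴬ
... | K≡K′ , refl with map-relabel-small (x′ ∷ L′) (subst (s ∈_) K≡K′ (Glued.s∈K (s≤s z≤n) Lᴬ σᴬ)) (Glued.s≤r (s≤s z≤n) Lᴬ σᴬ)
...   | refl = map-injective (mono-injective (relabel-mono (Glued.s≤r (s≤s z≤n) Lᴬ σᴬ))) K≡K′ , refl

-- Cutting an avoider at its maximum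

Unique-⊆ : ∀ {xs ys : List ℕ} → xs ⊆ ys → Unique ys → Unique xs
Unique-⊆ []           []         = []
Unique-⊆ (_ ∷ʳ xs⊆)   (_ ∷ ys!)  = Unique-⊆ xs⊆ ys!
Unique-⊆ (refl ∷ xs⊆) (x∉ ∷ ys!) = All-resp-⊆ xs⊆ x∉ ∷ Unique-⊆ xs⊆ ys!

-- In an occurrence of either pattern a leading maximum would have to be the first letter, which is
-- smaller than the last one.
∷-max-Avoider⁺ : ∀ {n R} → Avoider n R → Avoider (suc n) (n ∷ R)
∷-max-Avoider⁺ {n} {R} (mkAvoider len R<n R! av) = mkAvoider
  (cong suc len)
  (ℕ.n<1+n n ∷ All.map ℕ.m<n⇒m<1+n R<n)
  (All.map (λ c<n n≡c → ℕ.<-irrefl (sym n≡c) c<n) R<n ∷ R!)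
  avoids-n∷R
  where
  avoids-n∷R : Avoids (n ∷ R)
  avoids-n∷R (_ ∷ʳ s⊆)   = av s⊆
  avoids-n∷R (refl ∷ s⊆) n<c _ _ = ℕ.<-asym n<c (All.lookup R<n (lookup s⊆ (there (there (here refl)))))

∷-max-Avoider⁻ : ∀ {n R} → Avoider (suc n) (n ∷ R) → Avoider n R
∷-max-Avoider⁻ {n} (mkAvoider len (_ ∷ R≤n) (n∉R ∷ R!) av) = mkAvoider
  (ℕ.suc-injective len)
  (All.tabulate λ c∈ → ℕ.≤∧≢⇒< (ℕ.s≤s⁻¹ (All.lookup R≤n c∈)) (All.lookup n∉R c∈ ∘ sym))
  R!
  (Avoids-⊆ (n ∷ʳ ⊆-refl) av)

least : ∀ y ys → ∃[ m ] m ∈ y ∷ ys × All (m ≤_) (y ∷ ys)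
least y []       = y , here refl , ℕ.≤-refl ∷ []
least y (z ∷ ys) with least z ys
... | m , m∈ , m≤ with ℕ.≤-total y m
...   | inj₁ y≤m = y , here refl , ℕ.≤-refl ∷ All.map (ℕ.≤-trans y≤m) m≤
...   | inj₂ m≤y = m , there m∈ , m≤y ∷ m≤

map-surjective : ∀ {f : ℕ → ℕ} K → (∀ {v} → v ∈ K → ∃[ w ] f w ≡ v) → ∃[ L ] map f L ≡ K
map-surjective []      _   = [] , refl
map-surjective (v ∷ K) sur with sur (here refl) | map-surjective K (sur ∘ there)
... | w , refl | L , refl = w ∷ L , refl

module Unglue {a y K′ R} (πᴬ : Avoider (suc (suc a)) (y ∷ K′ ++ suc a ∷ R)) where

  K : List ℕ
  K = y ∷ K′

  i r : ℕ
  i = length K′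
  r = length R

  i+r≡a : i ℕ.+ r ≡ a
  i+r≡a = ℕ.suc-injective (trans (sym (ℕ.+-suc i r)) (trans (sym (length-++ K′)) (ℕ.suc-injective (len πᴬ))))

  m : ℕ
  m = proj₁ (least y K′)

  m∈K : m ∈ K
  m∈K = proj₁ (proj₂ (least y K′))

  m≤K : All (m ≤_) K
  m≤K = proj₂ (proj₂ (least y K′))

  σ⊆π : m ∷ R ⊆ K ++ suc a ∷ R
  σ⊆π = ++⁺ (from∈ m∈K) (suc a ∷ʳ ⊆-refl)

  K<top : ∀ {v} → v ∈ K → v < suc a
  K<top v∈ = ℕ.≤∧≢⇒< (ℕ.s≤s⁻¹ (All.lookup (bound πᴬ) (∈-++⁺ˡ v∈)))
                     (⊆-unique-pair (unique πᴬ) (++⁺ (from∈ v∈) (refl ∷ minimum R)))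

  R<top : ∀ {c} → c ∈ R → c < suc a
  R<top c∈ = ℕ.≤∧≢⇒< (ℕ.s≤s⁻¹ (All.lookup (bound πᴬ) (∈-++⁺ʳ K (there c∈))))
                     (⊆-unique-pair (unique πᴬ) (++⁺ˡ K (refl ∷ from∈ c∈)) ∘ sym)

  -- Otherwise m, v, the maximum and c would form 1243 or 2143.
  R<K : ∀ {v c} → v ∈ K → v ≢ m → c ∈ R → c < v
  R<K {v} {c} v∈ v≢m c∈ = ℕ.≰⇒> below
    where
    below : v ≤ c → ⊥
    below v≤c = [ (λ mv⊆ → avoid πᴬ (++⁺ mv⊆ (refl ∷ from∈ c∈)) m<c v<c (R<top c∈))
                , (λ vm⊆ → avoid πᴬ (++⁺ vm⊆ (refl ∷ from∈ c∈)) v<c m<c (R<top c∈)) ]′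
                (⊆-pair m∈K v∈ (v≢m ∘ sym))
      where
      v<c = ℕ.≤∧≢⇒< v≤c (⊆-unique-pair (unique πᴬ) (++⁺ (from∈ v∈) (suc a ∷ʳ from∈ c∈)))
      m<c = ℕ.≤-<-trans (All.lookup m≤K v∈) v<c

  σ<K : ∀ {v} → v ∈ K → v ≢ m → All (_< v) (m ∷ R)
  σ<K v∈ v≢m = ℕ.≤∧≢⇒< (All.lookup m≤K v∈) (v≢m ∘ sym) ∷ All.tabulate (R<K v∈ v≢m)

  σ! : Unique (m ∷ R)
  σ! = Unique-⊆ σ⊆π (unique πᴬ)

  -- Every value up to an entry c of m ∷ R occurs in π, hence in m ∷ R.
  σ≤r : ∀ {c} → c ∈ m ∷ R → c < suc r
  σ≤r {c} c∈ = subst (_≤ suc r) (length-upTo (suc c)) (length-unique-≤ (Unique.upTo⁺ (suc c)) (in-σ ∘ ℕ.s≤s⁻¹ ∘ ∈-upTo⁻))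
    where
    c<top : c < suc a
    c<top = All.lookup (K<top m∈K ∷ All.tabulate R<top) c∈
    in-σ : ∀ {w} → w ≤ c → w ∈ m ∷ R
    in-σ {w} w≤c with ∈-++⁻ K (full (unique πᴬ) (bound πᴬ) (len πᴬ) (ℕ.m<n⇒m<1+n (ℕ.≤-<-trans w≤c c<top)))
    ... | inj₂ (here refl) = ⊥-elim (ℕ.<⇒≱ c<top w≤c)
    ... | inj₂ (there w∈)  = there w∈
    ... | inj₁ w∈K with w ℕ.≟ m
    ...   | yes refl = here refl
    ...   | no w≢m   = ⊥-elim (ℕ.<⇒≱ (All.lookup (σ<K w∈K w≢m) c∈) w≤c)

  σᴬ : Avoider (suc r) (m ∷ R)
  σᴬ = mkAvoider refl (All.tabulate σ≤r) σ! (Avoids-⊆ σ⊆π (avoid πᴬ))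

  m≤r : m ≤ r
  m≤r = ℕ.s≤s⁻¹ (All.head (bound σᴬ))

  relabel-onto : ∀ {v} → v ∈ K → ∃[ w ] relabel m r w ≡ v
  relabel-onto {v} v∈ with v ℕ.≟ m
  ... | yes refl = 0 , refl
  -- The r + 1 distinct entries of `m ∷ R` all lie below `v`, so v is at least r + 1 and the
  -- preimage is v - r.
  ... | no  v≢m with ℕ.m≤n⇒∃[o]m+o≡n (length-bounded-≤ σ! (σ<K v∈ v≢m))
  ...   | w , refl = suc w , cong suc (ℕ.+-comm w r)

  L : List ℕ
  L = proj₁ (map-surjective K relabel-onto)

  map-L : map (relabel m r) L ≡ K
  map-L = proj₂ (map-surjective K relabel-onto)

  length-L : length L ≡ suc i
  length-L = trans (sym (length-map (relabel m r) L)) (cong length map-L)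

  Lᴬ : Avoider (suc i) L
  Lᴬ = mkAvoider length-L
    (All.map (λ {w} → relabel-<⁻ w) (All.map⁻ (subst (All (_< suc a)) (sym map-L) (All.tabulate K<top))))
    (Unique.map⁻ (subst Unique (sym map-L) (Unique-⊆ K⊆π (unique πᴬ))))
    (Avoids-map⁻ (relabel-mono m≤r) (subst Avoids (sym map-L) (Avoids-⊆ K⊆π (avoid πᴬ))))
    where
    K⊆π : K ⊆ K ++ suc a ∷ R
    K⊆π = ++⁺ʳ (suc a ∷ R) ⊆-refl
    relabel-<⁻ : ∀ w → relabel m r w < suc a → w < suc i
    relabel-<⁻ zero    _ = s≤s z≤n
    relabel-<⁻ (suc w) h = ℕ.+-cancelʳ-< r (suc w) (suc i) (subst (λ n → suc w ℕ.+ r < suc n) (sym i+r≡a) h)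

  glue≡π : glue L (m ∷ R) ≡ K ++ suc a ∷ R
  glue≡π = cong₂ (λ xs t → xs ++ t ∷ R) map-L (trans (cong (ℕ._+ r) length-L) (cong suc i+r≡a))

-- The bijection for avoiders of length at least 2

record Glue (a : ℕ) (p : List ℕ × List ℕ) : Set where
  constructor mkGlue
  field
    {i}   : ℕ
    i≤a   : i ≤ a
    left  : Avoider (suc i) (proj₁ p)
    right : Avoider (suc (a ∸ i)) (proj₂ p)

unglue : ∀ {a π} → Avoider (suc (suc a)) π →
         (∃[ R ] Avoider (suc a) R × π ≡ suc a ∷ R) ⊎ (∃[ p ] Glue a p × π ≡ uncurry glue p)
unglue {a} {π} πᴬ with ∈-∃++ (full (unique πᴬ) (bound πᴬ) (len πᴬ) (ℕ.n<1+n (suc a)))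
... | []     , R , refl = inj₁ (R , ∷-max-Avoider⁻ πᴬ , refl)
... | y ∷ K′ , R , refl = inj₂ ((L , m ∷ R) , mkGlue i≤a Lᴬ (subst (λ n → Avoider (suc n) (m ∷ R)) r≡a∸i σᴬ) , sym glue≡π)
  where
  open Unglue {a} {y} {K′} {R} πᴬ hiding (i)
  i≤a : length K′ ≤ a
  i≤a = subst (length K′ ≤_) i+r≡a (ℕ.m≤m+n (length K′) r)
  r≡a∸i : r ≡ a ∸ length K′
  r≡a∸i = trans (sym (ℕ.m+n∸m≡n (length K′) r)) (cong (_∸ length K′) i+r≡a)

Glue⇒Avoider : ∀ {a L σ} → Glue a (L , σ) → Avoider (suc (suc a)) (glue L σ)
Glue⇒Avoider {a} {x ∷ L} {s ∷ R} (mkGlue {i} i≤a Lᴬ σᴬ) = subst (λ n → Avoider n (glue (x ∷ L) (s ∷ R))) length≡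
  (Glued.glue-Avoider (s≤s z≤n) (subst (λ n → Avoider n (x ∷ L)) (sym (len Lᴬ)) Lᴬ) (subst (λ n → Avoider n (s ∷ R)) (sym (len σᴬ)) σᴬ))
  where
  length≡ : length (x ∷ L) ℕ.+ length (s ∷ R) ≡ suc (suc a)
  length≡ = trans (cong₂ ℕ._+_ (len Lᴬ) (len σᴬ)) (cong suc (trans (ℕ.+-suc i (a ∸ i)) (cong suc (ℕ.m+[n∸m]≡n i≤a))))

Glue⇒total : ∀ {a L σ} → Glue a (L , σ) → ∀ b → total b (glue L σ) ≡ total (up b) L + total b σ
Glue⇒total {a} {x ∷ L} {s ∷ R} (mkGlue i≤a Lᴬ σᴬ) =
  Glued.total-glue (s≤s z≤n) (subst (λ n → Avoider n (x ∷ L)) (sym (len Lᴬ)) Lᴬ) (subst (λ n → Avoider n (s ∷ R)) (sym (len σᴬ)) σᴬ)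

-- A glued word starts with an entry of K, which is below the maximum. Hence the two cases of the
-- decomposition exclude each other.
glue-head : ∀ {a R L σ} → Glue a (L , σ) → suc a ∷ R ≢ glue L σ
glue-head {a} {R} {x ∷ L} {s ∷ R′} (mkGlue {i} i≤a Lᴬ σᴬ) eq =
  ℕ.<-irrefl (sym (∷-injectiveˡ eq)) (subst (relabel s (length R′) x <_) (cong suc (trans (cong (i ℕ.+_) r≡a∸i) (ℕ.m+[n∸m]≡n i≤a)))
    (relabel-< (subst (s ≤_) (sym r≡a∸i) (ℕ.s≤s⁻¹ (All.head (bound σᴬ)))) (All.head (bound Lᴬ))))
  where
  r≡a∸i : length R′ ≡ a ∸ i
  r≡a∸i = ℕ.suc-injective (len σᴬ)

-- Both parts are nonempty, so lengths i + 1 and a - i + 1 with 0 ≤ i ≤ a give total length a + 2.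
-- The loops are nested in the order of `⊗`, so the products of weights come out as the convolution
-- without reordering.
gluePairs : ℕ → List (List ℕ × List ℕ)
gluePairs a = concatMap (λ i → concatMap (λ L → map (L ,_) (avoiders (suc (a ∸ i)))) (avoiders (suc i))) (upTo (suc a))

∈-pairs⁻ : ∀ {X Y : Set} (xs : List X) (ys : List Y) {x y} →
           (x , y) ∈ concatMap (λ z → map (z ,_) ys) xs → x ∈ xs × y ∈ ys
∈-pairs⁻ xs ys p∈ with find (∈-concatMap⁻ (λ z → map (z ,_) ys) {xs} p∈)
... | x , x∈ , p∈′ with ∈-map⁻ (x ,_) p∈′
...   | y , y∈ , refl = x∈ , y∈

∈-gluePairs⁺ : ∀ {a p} → Glue a p → p ∈ gluePairs a
∈-gluePairs⁺ (mkGlue i≤a Lᴬ σᴬ) =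
  ∈-concatMap⁺ _ (lose (∈-upTo⁺ (s≤s i≤a)) (∈-concatMap⁺ _ (lose (∈-avoiders⁺ Lᴬ) (∈-map⁺ _ (∈-avoiders⁺ σᴬ)))))

∈-gluePairs⁻ : ∀ {a p} → p ∈ gluePairs a → Glue a p
∈-gluePairs⁻ {a} p∈ with find (∈-concatMap⁻ (λ i → concatMap (λ L → map (L ,_) (avoiders (suc (a ∸ i)))) (avoiders (suc i))) {upTo (suc a)} p∈)
... | i , i∈ , p∈′ with ∈-pairs⁻ (avoiders (suc i)) (avoiders (suc (a ∸ i))) p∈′
...   | L∈ , σ∈ = mkGlue (ℕ.s≤s⁻¹ (∈-upTo⁻ i∈)) (∈-avoiders⁻ L∈) (∈-avoiders⁻ σ∈)

gluePairs-unique : ∀ a → Unique (gluePairs a)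
gluePairs-unique a = concatMap-unique
  (λ i → concatMap-unique (λ L → Unique.map⁺ (cong proj₂) (avoiders-unique (suc (a ∸ i)))) same-left (avoiders-unique (suc i)))
  (λ {i} {j} → same-index {i} {j}) (Unique.upTo⁺ (suc a))
  where
  same-left : ∀ {L L′ p} {ys : List (List ℕ)} → p ∈ map (L ,_) ys → p ∈ map (L′ ,_) ys → L ≡ L′
  same-left p∈ p∈′ with ∈-map⁻ _ p∈ | ∈-map⁻ _ p∈′
  ... | _ , _ , refl | _ , _ , refl = refl
  same-index : ∀ {i j p} → p ∈ concatMap (λ L → map (L ,_) (avoiders (suc (a ∸ i)))) (avoiders (suc i)) →
               p ∈ concatMap (λ L → map (L ,_) (avoiders (suc (a ∸ j)))) (avoiders (suc j)) → i ≡ j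
  same-index {i} {j} {p} p∈ p∈′ = ℕ.suc-injective (trans
    (sym (len (∈-avoiders⁻ {suc i} (proj₁ (∈-pairs⁻ (avoiders (suc i)) (avoiders (suc (a ∸ i))) p∈))))) (len (∈-avoiders⁻ {suc j} (proj₁ (∈-pairs⁻ (avoiders (suc j)) (avoiders (suc (a ∸ j))) p∈′)))))

Glue-injective : ∀ {a p q} → Glue a p → Glue a q → uncurry glue p ≡ uncurry glue q → p ≡ q
Glue-injective (mkGlue i≤a Lᴬ σᴬ) (mkGlue j≤a L′ᴬ σ′ᴬ) eq
  with refl , refl ← glue-injective Lᴬ σᴬ L′ᴬ σ′ᴬ (trans (ℕ.m+[n∸m]≡n i≤a) (sym (ℕ.m+[n∸m]≡n j≤a))) eq = refl

-- Both lists are free of repetitions, so it is enough that they have the same elements.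
avoiders-↭ : ∀ a → avoiders (suc (suc a)) ↭.↭ map (suc a ∷_) (avoiders (suc a)) ++ map (uncurry glue) (gluePairs a)
avoiders-↭ a = ∼bag⇒↭ (unique∧set⇒bag (avoiders-unique (suc (suc a)))
  (Unique.++⁺ (Unique.map⁺ ∷-injectiveʳ (avoiders-unique (suc a)))
    (map-unique (λ p∈ q∈ → Glue-injective (∈-gluePairs⁻ {a} p∈) (∈-gluePairs⁻ {a} q∈)) (gluePairs-unique a))
    disjoint)
  (mk⇔ (split ∘ ∈-avoiders⁻) (∈-avoiders⁺ ∘ join)))
  where
  disjoint : ∀ {π} → π ∈ map (suc a ∷_) (avoiders (suc a)) × π ∈ map (uncurry glue) (gluePairs a) → ⊥
  disjoint (π∈ , π∈′) with ∈-map⁻ _ π∈ | ∈-map⁻ _ π∈′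
  ... | _ , _ , refl | _ , p∈ , eq = glue-head (∈-gluePairs⁻ p∈) eq
  split : ∀ {π} → Avoider (suc (suc a)) π → π ∈ map (suc a ∷_) (avoiders (suc a)) ++ map (uncurry glue) (gluePairs a)
  split πᴬ with unglue πᴬ
  ... | inj₁ (R , Rᴬ , refl) = ∈-++⁺ˡ (∈-map⁺ _ (∈-avoiders⁺ Rᴬ))
  ... | inj₂ (p , pᴳ , refl) = ∈-++⁺ʳ _ (∈-map⁺ _ (∈-gluePairs⁺ pᴳ))
  join : ∀ {π} → π ∈ map (suc a ∷_) (avoiders (suc a)) ++ map (uncurry glue) (gluePairs a) → Avoider (suc (suc a)) π
  join π∈ with ∈-++⁻ (map (suc a ∷_) (avoiders (suc a))) π∈
  ... | inj₁ π∈′ with ∈-map⁻ _ π∈′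
  ...   | _ , R∈ , refl = ∷-max-Avoider⁺ (∈-avoiders⁻ R∈)
  join π∈ | inj₂ π∈′ with ∈-map⁻ _ π∈′
  ...   | _ , p∈ , refl = Glue⇒Avoider (∈-gluePairs⁻ p∈)

-- Multisets of monomials

-- Words are compared by propositional equality, monomials only pointwise; this passes from the one
-- kind of multiset equality to the other.
map-↭ : ∀ {X : Set} (f : X → Mon) {xs ys} → xs ↭.↭ ys → map f xs ≈ₘ map f ys
map-↭ f ↭.refl         = ↭-refl
map-↭ f (↭.prep x p)   = prep (λ _ → refl) (map-↭ f p)
map-↭ f (↭.swap x y p) = swap (λ _ → refl) (λ _ → refl) (map-↭ f p)
map-↭ f (↭.trans p q)  = ↭-trans (map-↭ f p) (map-↭ f q)

map-cong-∈ : ∀ {X : Set} {f g : X → Mon} xs → (∀ {x} → x ∈ xs → f x ≗ g x) → map f xs ≈ₘ map g xs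
map-cong-∈ []       f≗g = ↭-refl
map-cong-∈ (x ∷ xs) f≗g = prep (f≗g (here refl)) (map-cong-∈ xs (f≗g ∘ there))

map-·-cong : ∀ {m m′ p p′} → m ≗ m′ → p ≈ₘ p′ → map (m ·_) p ≈ₘ map (m′ ·_) p′
map-·-cong m≗ (Perm.refl p≋)      = Perm.refl (Pointwise.map⁺ _ _ (Pointwise.map (λ x≗ k → cong₂ _+_ (m≗ k) (x≗ k)) p≋))
map-·-cong m≗ (prep x≗ p≈)   = prep (λ k → cong₂ _+_ (m≗ k) (x≗ k)) (map-·-cong m≗ p≈)
map-·-cong m≗ (swap x≗ y≗ p≈) = swap (λ k → cong₂ _+_ (m≗ k) (x≗ k)) (λ k → cong₂ _+_ (m≗ k) (y≗ k)) (map-·-cong m≗ p≈)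
map-·-cong {m′ = m′} m≗ (Perm.trans p≈ q≈) = ↭-trans (map-·-cong m≗ p≈) (map-·-cong {m′} {m′} (λ _ → refl) q≈)

concatMap-cong-∈ : ∀ {X : Set} {f g : X → Poly} xs → (∀ {x} → x ∈ xs → f x ≈ₘ g x) → concatMap f xs ≈ₘ concatMap g xs
concatMap-cong-∈ []       f≈g = ↭-refl
concatMap-cong-∈ (x ∷ xs) f≈g = ++-cong (f≈g (here refl)) (concatMap-cong-∈ xs (f≈g ∘ there))

⊗-congʳ : ∀ p {q q′} → q ≈ₘ q′ → p ⊗ q ≈ₘ p ⊗ q′
⊗-congʳ p q≈ = concatMap-cong-∈ p (λ {m} _ → map-·-cong {m} {m} (λ _ → refl) q≈)

⊗-congˡ : ∀ {p p′} q → p ≈ₘ p′ → p ⊗ q ≈ₘ p′ ⊗ q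
⊗-congˡ q (Perm.refl [])        = ↭-refl
⊗-congˡ q (Perm.refl (x≗ ∷ p≋)) = ++-cong (map-·-cong x≗ ↭-refl) (⊗-congˡ q (Perm.refl p≋))
⊗-congˡ q (prep x≗ p≈)     = ++-cong (map-·-cong x≗ ↭-refl) (⊗-congˡ q p≈)
-- Exchanging two monomials of the left factor exchanges two whole blocks of the product.
⊗-congˡ q (swap {x = x} {y} {x′} {y′} x≗ y≗ p≈) = ↭-trans (shifts (map (x ·_) q) (map (y ·_) q))
  (++-cong (map-·-cong {y} {y′} {q} y≗ ↭-refl) (++-cong (map-·-cong {x} {x′} {q} x≗ ↭-refl) (⊗-congˡ q p≈)))
⊗-congˡ q (Perm.trans p≈ p′≈)   = ↭-trans (⊗-congˡ q p≈) (⊗-congˡ q p′≈)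

⊗-cong : ∀ p p′ q q′ → p ≈ₘ p′ → q ≈ₘ q′ → p ⊗ q ≈ₘ p′ ⊗ q′
⊗-cong p p′ q q′ p≈ q≈ = ↭-trans (⊗-congˡ q p≈) (⊗-congʳ p′ q≈)

[_]⊗ : ∀ m p → (m ∷ []) ⊗ p ≡ map (m ·_) p
[ m ]⊗ p = ++-identityʳ (map (m ·_) p)

-- The outer factor on the right comes from the second factor on the left, as in the recursion of
-- `Gfuel` after multiplication by `M A h`.
scale-⊗ : ∀ m m′ p q → map (m′ ·_) p ⊗ map (m ·_) q ≈ₘ map (m ·_) (map (m′ ·_) (p ⊗ q))
scale-⊗ m m′ []      q = ↭-refl
scale-⊗ m m′ (x ∷ p) q = begin
  map ((m′ · x) ·_) (map (m ·_) q) ++ (map (m′ ·_) p ⊗ map (m ·_) q)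
    ↭⟨ ++-cong head (scale-⊗ m m′ p q) ⟩
  map (m ·_) (map (m′ ·_) (map (x ·_) q)) ++ map (m ·_) (map (m′ ·_) (p ⊗ q))
    ≡⟨ map-++ (m ·_) (map (m′ ·_) (map (x ·_) q)) (map (m′ ·_) (p ⊗ q)) ⟨
  map (m ·_) (map (m′ ·_) (map (x ·_) q) ++ map (m′ ·_) (p ⊗ q))
    ≡⟨ cong (map (m ·_)) (map-++ (m′ ·_) (map (x ·_) q) (p ⊗ q)) ⟨
  map (m ·_) (map (m′ ·_) (map (x ·_) q ++ (p ⊗ q))) ∎
  where
  open Perm.PermutationReasoning
  rearrange : ∀ a b c d → b + c + (a + d) ≡ a + (b + (c + d))
  rearrange = solve-∀
  head : map ((m′ · x) ·_) (map (m ·_) q) ≈ₘ map (m ·_) (map (m′ ·_) (map (x ·_) q))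
  head = begin
    map ((m′ · x) ·_) (map (m ·_) q)              ≡⟨ map-∘ q ⟨
    map (λ y → (m′ · x) · (m · y)) q              ↭⟨ map-cong-∈ q (λ {y} _ k → rearrange (m k) (m′ k) (x k) (y k)) ⟩
    map (λ y → m · (m′ · (x · y))) q              ≡⟨ trans (map-∘ q) (cong (map (m ·_)) (map-∘ q)) ⟩
    map (m ·_) (map (m′ ·_) (map (x ·_) q))       ∎

singleton-⊗ : ∀ m m′ p q → ((m′ ∷ []) ⊗ p) ⊗ ((m ∷ []) ⊗ q) ≈ₘ (m ∷ []) ⊗ ((m′ ∷ []) ⊗ (p ⊗ q))
singleton-⊗ m m′ p q rewrite [ m′ ]⊗ p | [ m ]⊗ q | [ m′ ]⊗ (p ⊗ q) | [ m ]⊗ (map (m′ ·_) (p ⊗ q)) = scale-⊗ m m′ p q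

singleton-distrib : ∀ {X : Set} m p (f : X → Poly) xs →
                    (m ∷ []) ⊗ (p ++ concatMap f xs) ≡ (m ∷ []) ⊗ p ++ concatMap (λ x → (m ∷ []) ⊗ f x) xs
singleton-distrib m p f xs = trans ([ m ]⊗ (p ++ concatMap f xs)) (trans (map-++ (m ·_) p (concatMap f xs))
  (cong₂ _++_ (sym ([ m ]⊗ p)) (trans (map-concatMap (m ·_) f xs) (concatMap-cong (λ x → sym ([ m ]⊗ (f x))) xs))))

map-pairs : ∀ {X Y : Set} (f : X → Mon) (g : Y → Mon) xs ys →
            map (λ p → f (proj₁ p) · g (proj₂ p)) (concatMap (λ x → map (x ,_) ys) xs) ≡ map f xs ⊗ map g ys
map-pairs f g []       ys = refl
map-pairs f g (x ∷ xs) ys = trans (map-++ _ (map (x ,_) ys) _)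
  (cong₂ _++_ (trans (sym (map-∘ ys)) (map-∘ ys)) (map-pairs f g xs ys))

-- Recursions of the two generating functions

upMatrix : Matrix → Matrix
upMatrix A k n = A k n + A (suc k) n

-- A leading maximum adds only its own singleton, hence the factor `A 0`. In a glued word the left
-- part is weighted by `upMatrix A`, because the maximum extends its increasing subsequences.
Fcoef-suc-suc : ∀ A a → Fcoef A (suc (suc a)) ≈ₘ
  ((A 0 ∷ []) ⊗ Fcoef A (suc a)) ++ concatMap (λ i → Fcoef (upMatrix A) (suc i) ⊗ Fcoef A (suc (a ∸ i))) (upTo (suc a))
Fcoef-suc-suc A a = begin
  map (weight A) (avoiders (suc (suc a)))
    ↭⟨ map-↭ (weight A) (avoiders-↭ a) ⟩
  map (weight A) (map (suc a ∷_) (avoiders (suc a)) ++ map (uncurry glue) (gluePairs a))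
    ≡⟨ map-++ (weight A) (map (suc a ∷_) (avoiders (suc a))) (map (uncurry glue) (gluePairs a)) ⟩
  map (weight A) (map (suc a ∷_) (avoiders (suc a))) ++ map (weight A) (map (uncurry glue) (gluePairs a))
    ↭⟨ ++-cong max-first glued ⟩
  ((A 0 ∷ []) ⊗ Fcoef A (suc a)) ++ concatMap (λ i → Fcoef (upMatrix A) (suc i) ⊗ Fcoef A (suc (a ∸ i))) (upTo (suc a)) ∎
  where
  open Perm.PermutationReasoning
  max-first : map (weight A) (map (suc a ∷_) (avoiders (suc a))) ≈ₘ (A 0 ∷ []) ⊗ Fcoef A (suc a)
  max-first = begin
    map (weight A) (map (suc a ∷_) (avoiders (suc a)))       ≡⟨ map-∘ (avoiders (suc a)) ⟨
    map (λ π → weight A (suc a ∷ π)) (avoiders (suc a))      ↭⟨ map-cong-∈ (avoiders (suc a)) (λ {π} π∈ n →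
                                                                 trans (weight-total A (suc a ∷ π) n) (trans
                                                                   (total-max (col A n) (suc a) π (All.map ℕ.<⇒≤ (Avoider.bound (∈-avoiders⁻ π∈))))
                                                                   (cong (_+_ (A 0 n)) (sym (weight-total A π n))))) ⟩
    map (λ π → A 0 · weight A π) (avoiders (suc a))          ≡⟨ map-∘ (avoiders (suc a)) ⟩
    map (A 0 ·_) (Fcoef A (suc a))                           ≡⟨ [ A 0 ]⊗ (Fcoef A (suc a)) ⟨
    (A 0 ∷ []) ⊗ Fcoef A (suc a)                             ∎
  weights : List ℕ × List ℕ → Mon
  weights (L , σ) = weight (upMatrix A) L · weight A σ
  glued : map (weight A) (map (uncurry glue) (gluePairs a)) ≈ₘ
          concatMap (λ i → Fcoef (upMatrix A) (suc i) ⊗ Fcoef A (suc (a ∸ i))) (upTo (suc a))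
  glued = begin
    map (weight A) (map (uncurry glue) (gluePairs a))        ≡⟨ map-∘ (gluePairs a) ⟨
    map (weight A ∘ uncurry glue) (gluePairs a)              ↭⟨ map-cong-∈ (gluePairs a) (λ { {L , σ} p∈ n →
                                                                 trans (weight-total A (glue L σ) n) (trans
                                                                   (Glue⇒total (∈-gluePairs⁻ {a} p∈) (col A n))
                                                                   (sym (cong₂ _+_ (weight-total (upMatrix A) L n) (weight-total A σ n)))) }) ⟩
    map weights (gluePairs a)                                ≡⟨ map-concatMap weights _ (upTo (suc a)) ⟩
    concatMap (λ i → map weights (concatMap (λ L → map (L ,_) (avoiders (suc (a ∸ i)))) (avoiders (suc i)))) (upTo (suc a))
      ≡⟨ concatMap-cong (λ i → map-pairs (weight (upMatrix A)) (weight A) (avoiders (suc i)) (avoiders (suc (a ∸ i)))) (upTo (suc a)) ⟩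
    concatMap (λ i → Fcoef (upMatrix A) (suc i) ⊗ Fcoef A (suc (a ∸ i))) (upTo (suc a)) ∎

-- The invariant of the induction: the fraction keeps its matrix `X` and moves down to level h,
-- while on the side of the permutations `A` changes. One level down corresponds to one application
-- of `upMatrix`.
RowsFrom : Matrix → ℕ → Matrix → Set
RowsFrom X h A = ∀ i n → X (i ℕ.+ h) n ≡ lowerMul B A i n

RowsFrom-head : ∀ X h A → RowsFrom X h A → A 0 ≗ M X h
RowsFrom-head X h A X≡ n = sym (trans (X≡ 0 n) (trans (ℤ.+-identityʳ (+ 1 * A 0 n)) (ℤ.*-identityˡ (A 0 n))))

RowsFrom-suc : ∀ X h A → RowsFrom X h A → RowsFrom X (suc h) (upMatrix A)
RowsFrom-suc X h A X≡ i n = trans (cong (λ j → X j n) (ℕ.+-suc i h)) (trans (X≡ (suc i) n)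
  (trans (lowerMul-∑ B A (suc i) n) (trans (B-row-suc i (col A n)) (sym (lowerMul-∑ B (upMatrix A) i n)))))

-- The only permutation of length 1 has one increasing subsequence of length 1, so its weight is the
-- first row of `A`, which is also the first row of BA.
Fcoef-one : ∀ X h A → RowsFrom X h A → Fcoef A 1 ≈ₘ (M X h ∷ []) ⊗ (one ∷ [])
Fcoef-one X h A X≡ = prep (λ n → cong (_+ + 0) (trans (ℤ.*-identityʳ (A 0 n)) (RowsFrom-head X h A X≡ n))) ↭-refl

-- Multiplied by m = `M X h`, the recursion of G at level h reads mG = m + m(mG) + (m′G′)(mG), with
-- m′ and G′ from the next level. This is the recursion of the permutations, with m′G′ in the place
-- of the left parts. The induction is on the fuel, for all levels and matrices together.
Fcoef-Gfuel : ∀ n {a} X h A → a ≤ n → RowsFrom X h A → Fcoef A (suc a) ≈ₘ (M X h ∷ []) ⊗ Gfuel X n h a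
Fcoef-Gfuel zero    X h A z≤n X≡ = Fcoef-one X h A X≡
Fcoef-Gfuel (suc n) X h A z≤n X≡ = Fcoef-one X h A X≡
Fcoef-Gfuel (suc n) {suc a} X h A (s≤s a≤n) X≡ = begin
  Fcoef A (suc (suc a))
    ↭⟨ Fcoef-suc-suc A a ⟩
  ((A 0 ∷ []) ⊗ Fcoef A (suc a)) ++ concatMap (λ i → Fcoef (upMatrix A) (suc i) ⊗ Fcoef A (suc (a ∸ i))) (upTo (suc a))
    ↭⟨ ++-cong (⊗-cong (A 0 ∷ []) m (Fcoef A (suc a)) (m ⊗ G h a) (prep (RowsFrom-head X h A X≡) ↭-refl) (Fcoef-Gfuel n X h A a≤n X≡))
               (concatMap-cong-∈ (upTo (suc a)) product) ⟩
  (m ⊗ (m ⊗ G h a)) ++ concatMap (λ i → m ⊗ (m′ ⊗ (G (suc h) i ⊗ G h (a ∸ i)))) (upTo (suc a))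
    ≡⟨ singleton-distrib (M X h) (m ⊗ G h a) (λ i → m′ ⊗ (G (suc h) i ⊗ G h (a ∸ i))) (upTo (suc a)) ⟨
  m ⊗ Gfuel X (suc n) h (suc a) ∎
  where
  open Perm.PermutationReasoning
  m m′ : Poly
  m  = M X h ∷ []
  m′ = M X (suc h) ∷ []
  G : ℕ → ℕ → Poly
  G = Gfuel X n
  product : ∀ {i} → i ∈ upTo (suc a) → Fcoef (upMatrix A) (suc i) ⊗ Fcoef A (suc (a ∸ i)) ≈ₘ
                                       m ⊗ (m′ ⊗ (G (suc h) i ⊗ G h (a ∸ i)))
  product {i} i∈ = ↭-trans
    (⊗-cong (Fcoef (upMatrix A) (suc i)) (m′ ⊗ G (suc h) i) (Fcoef A (suc (a ∸ i))) (m ⊗ G h (a ∸ i))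
      (Fcoef-Gfuel n X (suc h) (upMatrix A) (ℕ.≤-trans (ℕ.s≤s⁻¹ (∈-upTo⁻ i∈)) a≤n) (RowsFrom-suc X h A X≡))
      (Fcoef-Gfuel n X h A (ℕ.≤-trans (ℕ.m∸n≤m a i) a≤n) X≡))
    (singleton-⊗ (M X h) (M X (suc h)) (G (suc h) i) (G h (a ∸ i)))

-- The relation of `X` to BA is a pointwise hypothesis so that `X` may be BA itself or a given
-- matrix of which `A` is the image under B⁻¹.
Fcoef-Ccoef : ∀ X A → (∀ i n → X i n ≡ lowerMul B A i n) → ∀ len → Fcoef A len ≈ₘ Ccoef X len
Fcoef-Ccoef X A X≡BA zero      = prep (λ _ → refl) ↭-refl
Fcoef-Ccoef X A X≡BA (suc len) = Fcoef-Gfuel len X 0 A ℕ.≤-refl (λ i n → trans (cong (λ j → X j n) (ℕ.+-identityʳ i)) (X≡BA i n))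

lowerMul-B-Binv : ∀ A i n → lowerMul B (lowerMul Binv A) i n ≡ A i n
lowerMul-B-Binv A i n = trans (lowerMul-∑ B (lowerMul Binv A) i n)
  (trans (row-cong B i (λ k → lowerMul-∑ Binv A k n)) (B∘Binv i (col A n)))

theorem5p12 : (∀ (A : Matrix) → RowFinite A → ∀ (len : ℕ) → Fcoef A len ≈ₘ Ccoef (lowerMul B A) len)
    × (∀ (A : Matrix) → RowFinite A → ∀ (len : ℕ) → Ccoef A len ≈ₘ Fcoef (lowerMul Binv A) len)
theorem5p12 =
    (λ A _ → Fcoef-Ccoef (lowerMul B A) A (λ _ _ → refl))
  -- The second identity is the first one for B⁻¹A, read backwards, since B(B⁻¹A) = A.
  , (λ A _ len → ↭-sym (Fcoef-Ccoef A (lowerMul Binv A) (λ i n → sym (lowerMul-B-Binv A i n)) len))
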